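{- For all expressions $e,f\in\mathcal E(X)$ we have $e\equiv f$ if and only if $e\simeq f$.
   Context: Fix a set $X$ of variables. Expressions $\mathcal E(X)$ are generated by $e,f::= x \mid 0\mid 1\mid e+f\mid e\cdot f\mid e\cap f\mid e^+\mid \overline{e}$ ($x\in X$; $\overline e$ is the mirror operation). Semantics: for an alphabet $\Sigma$ and $\sigma:X\to\mathcal P(\Sigma^\star)$, $[\![x]\!]_\sigma=\sigma(x)$, $[\![0]\!]_\sigma=\emptyset$, $[\![1]\!]_\sigma=\{\epsilon\}$, $+$ is union, $\cap$ intersection, $\cdot$ language concatenation, $e^+$ is $\bigcup_{n\ge1}[\![e]\!]_\sigma^n$, and $\overline e$ is the set of reversed words of $[\![e]\!]_\sigma$. Write $e\simeq f$ iff $[\![e]\!]_\sigma=[\![f]\!]_\sigma$ for every alphabet $\Sigma$ and every $\sigma:X\to\mathcal P(\Sigma^\star)$. The relation $\equiv$ is the smallest congruence on $\mathcal E(X)$ containing, for all $e,f,g$: $e+f=f+e$; $e+(f+g)=(e+f)+g$; $e+0=e$; $e\cap f=f\cap e$; $e\cap e=e$; $e\cap(f\cap g)=(e\cap f)\cap g$; $(e+f)\cap g=e\cap g+f\cap g$; $(e\cap f)+e=e$; $e\cdot(f\cdot g)=(e\cdot f)\cdot g$; $e\cdot 0=0=0\cdot e$; $(e+f)\cdot g=e\cdot g+f\cdot g$; $e\cdot(f+g)=e\cdot f+e\cdot g$; $e^+=e+e\cdot e^+$; $e^+=e+e^+\cdot e$; $\overline{\overline e}=e$; $\overline{e+f}=\overline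 e+\overline f$; $\overline{e\cdot f}=\overline f\cdot\overline e$; $\overline{e\cap f}=\overline e\cap\overline f$; $\overline{e^+}=\overline e^{\,+}$; $1\cdot e=e=e\cdot 1$; $1\cap(e\cdot f)=1\cap(e\cap f)$; $1\cap\overline e=1\cap e$; $(1\cap e)\cdot f=f\cdot(1\cap e)$; $((1\cap e)\cdot f)\cap g=(1\cap e)\cdot(f\cap g)$; $(g+(1\cap e)\cdot f)^+=g^++(1\cap e)\cdot(g+f)^+$; and closed under the rules: if $e\cdot f+f\equiv f$ then $e^+\cdot f+f\equiv f$; if $f\cdot e+f\equiv f$ then $f\cdot e^++f\equiv f$. -}

module Defs where

open import Data.Nat using (ℕ; zero; suc)
open import Data.List using (List; []; _++_; reverse)
open import Data.Product using (Σ; ∃; _×_; _,_)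
open import Data.Sum using (_⊎_)
open import Data.Empty using (⊥)
open import Relation.Binary.PropositionalEquality using (_≡_)
open import Function.Bundles using (_⇔_)

infixl 5 _⊕_
infixl 6 _⊓_
infixl 7 _⊙_
infix 9 _⁺

data Exp (X : Set) : Set where
  var  : X → Exp X
  𝟎 𝟏  : Exp X
  _⊕_  : Exp X → Exp X → Exp X
  _⊙_  : Exp X → Exp X → Exp X
  _⊓_  : Exp X → Exp X → Exp X
  _⁺   : Exp X → Exp X
  rev  : Exp X → Exp X

Lang : Set → Set₁
Lang A = List A → Set

_∙_ : {A : Set} → Lang A → Lang A → Lang A
(K ∙ L) w = Σ _ λ u → Σ _ λ v → (w ≡ u ++ v) × K u × L v

-- Pow L n = L^(n+1)
Pow : {A : Set} → Lang A → ℕ → Lang A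
Pow L zero    = L
Pow L (suc n) = L ∙ Pow L n

⟦_⟧ : {X A : Set} → Exp X → (X → Lang A) → Lang A
⟦ var x ⟧ σ w = σ x w
⟦ 𝟎 ⟧ σ w = ⊥
⟦ 𝟏 ⟧ σ w = w ≡ []
⟦ e ⊕ f ⟧ σ w = ⟦ e ⟧ σ w ⊎ ⟦ f ⟧ σ w
⟦ e ⊙ f ⟧ σ w = (⟦ e ⟧ σ ∙ ⟦ f ⟧ σ) w
⟦ e ⊓ f ⟧ σ w = ⟦ e ⟧ σ w × ⟦ f ⟧ σ w
⟦ e ⁺ ⟧ σ w = ∃ λ n → Pow (⟦ e ⟧ σ) n w
⟦ rev e ⟧ σ w = ⟦ e ⟧ σ (reverse w)

infix 4 _≃_
_≃_ : {X : Set} → Exp X → Exp X → Set₁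
e ≃ f = ∀ (A : Set) (σ : _ → Lang A) (w : List A) → ⟦ e ⟧ σ w ⇔ ⟦ f ⟧ σ w

infix 4 _≡ₑ_
data _≡ₑ_ {X : Set} : Exp X → Exp X → Set where
  refl  : ∀ {e} → e ≡ₑ e
  sym   : ∀ {e f} → e ≡ₑ f → f ≡ₑ e
  trans : ∀ {e f g} → e ≡ₑ f → f ≡ₑ g → e ≡ₑ g
  ⊕-cong : ∀ {e e' f f'} → e ≡ₑ e' → f ≡ₑ f' → e ⊕ f ≡ₑ e' ⊕ f'
  ⊙-cong : ∀ {e e' f f'} → e ≡ₑ e' → f ≡ₑ f' → e ⊙ f ≡ₑ e' ⊙ f'
  ⊓-cong : ∀ {e e' f f'} → e ≡ₑ e' → f ≡ₑ f' → e ⊓ f ≡ₑ e' ⊓ f'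
  ⁺-cong : ∀ {e e'} → e ≡ₑ e' → e ⁺ ≡ₑ e' ⁺
  rev-cong : ∀ {e e'} → e ≡ₑ e' → rev e ≡ₑ rev e'
  ⊕-comm  : ∀ e f → e ⊕ f ≡ₑ f ⊕ e
  ⊕-assoc : ∀ e f g → e ⊕ (f ⊕ g) ≡ₑ (e ⊕ f) ⊕ g
  ⊕-zero  : ∀ e → e ⊕ 𝟎 ≡ₑ e
  ⊓-comm  : ∀ e f → e ⊓ f ≡ₑ f ⊓ e
  ⊓-idem  : ∀ e → e ⊓ e ≡ₑ e
  ⊓-assoc : ∀ e f g → e ⊓ (f ⊓ g) ≡ₑ (e ⊓ f) ⊓ g
  ⊓-distr : ∀ e f g → (e ⊕ f) ⊓ g ≡ₑ e ⊓ g ⊕ f ⊓ g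
  absorb  : ∀ e f → (e ⊓ f) ⊕ e ≡ₑ e
  ⊙-assoc : ∀ e f g → e ⊙ (f ⊙ g) ≡ₑ (e ⊙ f) ⊙ g
  ⊙-zeroʳ : ∀ e → e ⊙ 𝟎 ≡ₑ 𝟎
  ⊙-zeroˡ : ∀ e → 𝟎 ⊙ e ≡ₑ 𝟎
  ⊙-distrʳ : ∀ e f g → (e ⊕ f) ⊙ g ≡ₑ e ⊙ g ⊕ f ⊙ g
  ⊙-distrˡ : ∀ e f g → e ⊙ (f ⊕ g) ≡ₑ e ⊙ f ⊕ e ⊙ g
  ⁺-unfoldˡ : ∀ e → e ⁺ ≡ₑ e ⊕ e ⊙ e ⁺
  ⁺-unfoldʳ : ∀ e → e ⁺ ≡ₑ e ⊕ e ⁺ ⊙ e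
  rev-rev : ∀ e → rev (rev e) ≡ₑ e
  rev-⊕   : ∀ e f → rev (e ⊕ f) ≡ₑ rev e ⊕ rev f
  rev-⊙   : ∀ e f → rev (e ⊙ f) ≡ₑ rev f ⊙ rev e
  rev-⊓   : ∀ e f → rev (e ⊓ f) ≡ₑ rev e ⊓ rev f
  rev-⁺   : ∀ e → rev (e ⁺) ≡ₑ (rev e) ⁺
  ⊙-unitˡ : ∀ e → 𝟏 ⊙ e ≡ₑ e
  ⊙-unitʳ : ∀ e → e ⊙ 𝟏 ≡ₑ e
  ax-1⊙   : ∀ e f → 𝟏 ⊓ (e ⊙ f) ≡ₑ 𝟏 ⊓ (e ⊓ f)
  ax-1rev : ∀ e → 𝟏 ⊓ rev e ≡ₑ 𝟏 ⊓ e
  ax-comm : ∀ e f → (𝟏 ⊓ e) ⊙ f ≡ₑ f ⊙ (𝟏 ⊓ e)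
  ax-⊓    : ∀ e f g → ((𝟏 ⊓ e) ⊙ f) ⊓ g ≡ₑ (𝟏 ⊓ e) ⊙ (f ⊓ g)
  ax-⁺    : ∀ e f g → (g ⊕ (𝟏 ⊓ e) ⊙ f) ⁺ ≡ₑ g ⁺ ⊕ (𝟏 ⊓ e) ⊙ (g ⊕ f) ⁺
  ind-ˡ : ∀ {e f} → e ⊙ f ⊕ f ≡ₑ f → e ⁺ ⊙ f ⊕ f ≡ₑ f
  ind-ʳ : ∀ {e f} → f ⊙ e ⊕ f ≡ₑ f → f ⊙ e ⁺ ⊕ f ≡ₑ f

{-# OPTIONS --safe #-}
module Submission where

-- Soundness is a check of the axioms. For completeness, write e ≤ f for e ⊕ f ≡ₑ f.
--
-- Identity-free case. The words of an identity-free expression are governed by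
-- series-parallel graphs u. By recursion on f every graph u gets a type ty u, ranging
-- over a finite set, and every type a bound, an expression ⌈ u ⌉, such that
-- ⌈ u ⌉ ⊙ ⌈ v ⌉ ≤ ⌈ u ⨟ v ⌉, ⌈ u ⌉ ⊓ ⌈ v ⌉ ≤ ⌈ u ∥ v ⌉, and ⌈ u ⌉ ≤ f whenever u satisfies f.
-- For a product f ⨾ g the type of u collects the types (of x for f, of y for g) of all ways
-- to cut u into x followed by y, and the bound is the meet of the products ⌈ x ⌉ ⊙ ⌈ y ⌉
-- (iterations are similar); it is the presence of meets that makes such bounds
-- expressible. Induction on e then gives e ≤ Σ ⌈ u ⌉ for finitely many graphs u of e, and
-- either all of them satisfy f, or one of them is a counterexample. Laying out that
-- graph along a word with distinct letters yields a separating interpretation.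
--
-- General case. For a set A of variables let α A be the meet of 𝟏 and of the
-- variables in A. Then e is the sum over all A of α A ⊙ (pos A e ⊕ null A e), where pos A e
-- is identity-free and describes the nonempty words of e when exactly the
-- variables in A contain the empty word.

open import Defs
open import Data.Bool using (Bool; true; false; not; _∧_; _∨_; if_then_else_)
import Data.Bool
import Data.Bool.Properties as Bool
open import Data.Empty using (⊥; ⊥-elim)
open import Data.Fin as Fin using (Fin; _↑ˡ_; _↑ʳ_; splitAt; punchIn; punchOut)
import Data.Fin.Properties as Fin
open import Data.List using (List; []; _∷_; _++_; foldr; map; filter; length; reverse; cartesianProduct; allFin)
open import Data.List.Membership.Propositional using (_∈_; find; lose)
open import Data.List.Membership.Propositional.Properties using (∈-map⁺; ∈-map⁻; ∈-++⁺ˡ; ∈-++⁺ʳ; ∈-++⁻; ∈-cartesianProduct⁺; ∈-cartesianProduct⁻; ∈-filter⁺; ∈-filter⁻; ∈-allFin)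
open import Data.List.Properties using (≡-dec; filter-notAll; ++-assoc; ++-identityʳ; reverse-involutive; reverse-injective; reverse-++; ∷-injectiveˡ; ∷-injectiveʳ)
open import Data.List.Relation.Unary.Any using (here; there; any?)
open import Data.Nat as ℕ using (ℕ; zero; suc)
import Data.Nat.Properties as ℕ
open import Data.Product using (Σ; ∃; ∃₂; _×_; _,_; proj₁; proj₂)
open import Data.Product.Properties using () renaming (≡-dec to ×-≡-dec)
open import Data.Sum using (_⊎_; inj₁; inj₂; [_,_]′)
open import Data.Unit using (⊤; tt)
open import Data.Vec using (Vec; []; _∷_; lookup; zipWith; replicate; tabulate)
open import Data.Vec.Properties using (lookup-zipWith; lookup∘tabulate; lookup-replicate)
open import Function using (_∘_)
open import Function.Bundles using (_⇔_; mk⇔; Equivalence)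
open import Relation.Binary using (DecidableEquality; Poset)
open import Relation.Binary.PropositionalEquality as ≡ using (_≡_; _≢_; _≗_)
import Relation.Binary.Reasoning.PartialOrder as PosetReasoning
open import Relation.Nullary using (Dec; yes; no; does; ¬_; ¬?; _×-dec_; _⊎-dec_; map′; contradiction)
open import Relation.Nullary.Decidable using (decidable-stable)

-- The axioms relate `⊓` to `⊙` and `⁺` only through expressions of the form `𝟏 ⊓ e`. In the
-- identity-free case a meet is therefore handled by its universal property: to lie below a bound,
-- it is enough to lie below each of its members, one cut at a time, and to use a bound, a single
-- member is picked. A graph may be replaced by another one of the same type because the bound
-- depends on the type alone; this is what makes an iteration stop after finitely many graphs.
-- Passing to variables in `Fin k` serves two purposes: the signature has no greatest element, and
-- the iterated sum of all letters takes its place; and the tests `A` can be enumerated. There is no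
-- complement either, so `α A` says that the variables in `A` contain the empty word and nothing
-- about the others. The summands of the expansion overlap, and they are combined by taking unions
-- of tests and using monotonicity in `A`.

private variable
  X Y I J A : Set
  a b e e' f f' g x y z : Exp X
  K K' L L' M : Lang A

-- The order on expressions

infix 4 _≤_
_≤_ : Exp X → Exp X → Set
e ≤ f = e ⊕ f ≡ₑ f

-- This is `absorb` at `f = e`, once `⊓-idem` has turned one summand into a meet.
⊕-idem : ∀ (e : Exp X) → e ⊕ e ≡ₑ e
⊕-idem e = trans (⊕-cong (sym (⊓-idem e)) refl) (absorb e e)

≤-reflexive : e ≡ₑ f → e ≤ f
≤-reflexive p = trans (⊕-cong p refl) (⊕-idem _)

≤-refl : e ≤ e
≤-refl = ⊕-idem _

≤-trans : e ≤ f → f ≤ g → e ≤ g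
≤-trans {e = e} {f = f} {g = g} p q =
  trans (⊕-cong refl (sym q)) (trans (⊕-assoc e f g) (trans (⊕-cong p refl) q))

≤-antisym : e ≤ f → f ≤ e → e ≡ₑ f
≤-antisym {e = e} {f = f} p q = trans (sym q) (trans (⊕-comm f e) p)

≤-poset : Set → Poset _ _ _
≤-poset X = record
  { Carrier = Exp X
  ; _≈_ = _≡ₑ_
  ; _≤_ = _≤_
  ; isPartialOrder = record
    { isPreorder = record
      { isEquivalence = record { refl = refl ; sym = sym ; trans = trans }
      ; reflexive = ≤-reflexive
      ; trans = ≤-trans }
    ; antisym = ≤-antisym } }

module ≤-Reasoning {X : Set} = PosetReasoning (≤-poset X)

⊕-ub₁ : e ≤ e ⊕ f
⊕-ub₁ {e = e} {f = f} = trans (⊕-assoc e e f) (⊕-cong (⊕-idem e) refl)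

⊕-ub₂ : f ≤ e ⊕ f
⊕-ub₂ {f = f} {e = e} = ≤-trans ⊕-ub₁ (≤-reflexive (⊕-comm f e))

⊕-lub : e ≤ g → f ≤ g → e ⊕ f ≤ g
⊕-lub {e = e} {g = g} {f = f} p q = trans (sym (⊕-assoc e f g)) (trans (⊕-cong refl q) p)

⊕-mono : e ≤ e' → f ≤ f' → e ⊕ f ≤ e' ⊕ f'
⊕-mono p q = ⊕-lub (≤-trans p ⊕-ub₁) (≤-trans q ⊕-ub₂)

𝟎-min : 𝟎 ≤ e
𝟎-min {e = e} = trans (⊕-comm 𝟎 e) (⊕-zero e)

⊓-lb₁ : e ⊓ f ≤ e
⊓-lb₁ {e = e} {f = f} = absorb e f

⊓-lb₂ : e ⊓ f ≤ f
⊓-lb₂ {e = e} {f = f} = ≤-trans (≤-reflexive (⊓-comm e f)) ⊓-lb₁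

⊓-monoˡ : e ≤ e' → e ⊓ f ≤ e' ⊓ f
⊓-monoˡ {e = e} {e' = e'} {f = f} p = trans (sym (⊓-distr e e' f)) (⊓-cong p refl)

⊓-mono : e ≤ e' → f ≤ f' → e ⊓ f ≤ e' ⊓ f'
⊓-mono {e' = e'} {f = f} {f' = f'} p q = ≤-trans (⊓-monoˡ p)
  (≤-trans (≤-reflexive (⊓-comm e' f)) (≤-trans (⊓-monoˡ q) (≤-reflexive (⊓-comm f' e'))))

⊓-glb : g ≤ e → g ≤ f → g ≤ e ⊓ f
⊓-glb {g = g} p q = ≤-trans (≤-reflexive (sym (⊓-idem g))) (⊓-mono p q)

⊙-mono : e ≤ e' → f ≤ f' → e ⊙ f ≤ e' ⊙ f'
⊙-mono {e = e} {e' = e'} {f = f} {f' = f'} p q = ≤-trans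
  (trans (sym (⊙-distrʳ e e' f)) (⊙-cong p refl))
  (trans (sym (⊙-distrˡ e' f f')) (⊙-cong refl q))

rev-mono : e ≤ f → rev e ≤ rev f
rev-mono {e = e} {f = f} p = trans (sym (rev-⊕ e f)) (rev-cong p)

e≤e⁺ : e ≤ e ⁺
e≤e⁺ {e = e} = ≤-trans ⊕-ub₁ (≤-reflexive (sym (⁺-unfoldˡ e)))

e⊙e⁺≤e⁺ : e ⊙ e ⁺ ≤ e ⁺
e⊙e⁺≤e⁺ {e = e} = ≤-trans ⊕-ub₂ (≤-reflexive (sym (⁺-unfoldˡ e)))

e⁺⊙e⁺≤e⁺ : e ⁺ ⊙ e ⁺ ≤ e ⁺
e⁺⊙e⁺≤e⁺ = ind-ˡ e⊙e⁺≤e⁺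

-- `ind-ˡ` bounds `e ⁺ ⊙ y`, not `e ⁺` itself. Unfolding on the right exposes a last factor `e`,
-- which is enlarged to `y` so that the rule applies.
⁺-least : e ≤ y → e ⊙ y ≤ y → e ⁺ ≤ y
⁺-least {e = e} {y = y} p q = begin
  e ⁺            ≈⟨ ⁺-unfoldʳ e ⟩
  e ⊕ e ⁺ ⊙ e    ≤⟨ ⊕-mono p (⊙-mono ≤-refl p) ⟩
  y ⊕ e ⁺ ⊙ y    ≤⟨ ⊕-lub ≤-refl (ind-ˡ q) ⟩
  y              ∎
  where open ≤-Reasoning

⁺-mono : e ≤ f → e ⁺ ≤ f ⁺
⁺-mono p = ⁺-least (≤-trans p e≤e⁺) (≤-trans (⊙-mono p ≤-refl) e⊙e⁺≤e⁺)

⊕⊙-lub : x ⊙ z ≤ g → y ⊙ z ≤ g → (x ⊕ y) ⊙ z ≤ g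
⊕⊙-lub {x = x} {z = z} {y = y} p q = ≤-trans (≤-reflexive (⊙-distrʳ x y z)) (⊕-lub p q)

⊙⊕-lub : z ⊙ x ≤ g → z ⊙ y ≤ g → z ⊙ (x ⊕ y) ≤ g
⊙⊕-lub {z = z} {x = x} {y = y} p q = ≤-trans (≤-reflexive (⊙-distrˡ z x y)) (⊕-lub p q)

⊕⊓-lub : x ⊓ z ≤ g → y ⊓ z ≤ g → (x ⊕ y) ⊓ z ≤ g
⊕⊓-lub {x = x} {z = z} {y = y} p q = ≤-trans (≤-reflexive (⊓-distr x y z)) (⊕-lub p q)

⊓⊕-lub : z ⊓ x ≤ g → z ⊓ y ≤ g → z ⊓ (x ⊕ y) ≤ g
⊓⊕-lub {z = z} {x = x} {y = y} p q = ≤-trans (≤-reflexive (⊓-comm z (x ⊕ y)))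
  (⊕⊓-lub (≤-trans (≤-reflexive (⊓-comm x z)) p) (≤-trans (≤-reflexive (⊓-comm y z)) q))

-- Finite sums.

sum : (I → Exp X) → List I → Exp X
sum F = foldr (λ i r → F i ⊕ r) 𝟎

sum-ub : ∀ (F : I → Exp X) {i is} → i ∈ is → F i ≤ sum F is
sum-ub F (here ≡.refl) = ⊕-ub₁
sum-ub F (there p)     = ≤-trans (sum-ub F p) ⊕-ub₂

sum-lub : ∀ (F : I → Exp X) is → (∀ {i} → i ∈ is → F i ≤ y) → sum F is ≤ y
sum-lub F []       h = 𝟎-min
sum-lub F (i ∷ is) h = ⊕-lub (h (here ≡.refl)) (sum-lub F is (λ p → h (there p)))

sum-⊙-lub : ∀ (F : I → Exp X) (G : J → Exp X) is js →
  (∀ {i j} → i ∈ is → j ∈ js → F i ⊙ G j ≤ y) → sum F is ⊙ sum G js ≤ y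
sum-⊙-lub F G [] js h = ≤-trans (≤-reflexive (⊙-zeroˡ _)) 𝟎-min
sum-⊙-lub {X = X} {y = y} F G (i ∷ is) js h =
  ⊕⊙-lub (go js (h (here ≡.refl))) (sum-⊙-lub F G is js (λ p → h (there p)))
  where
  go : ∀ js → (∀ {j} → j ∈ js → F i ⊙ G j ≤ y) → F i ⊙ sum G js ≤ y
  go []       k = ≤-trans (≤-reflexive (⊙-zeroʳ _)) 𝟎-min
  go (j ∷ js) k = ⊙⊕-lub (k (here ≡.refl)) (go js (λ p → k (there p)))

sum-⊓-lub : ∀ (F : I → Exp X) (G : J → Exp X) is js →
  (∀ {i j} → i ∈ is → j ∈ js → F i ⊓ G j ≤ y) → sum F is ⊓ sum G js ≤ y
sum-⊓-lub F G [] js h = ≤-trans ⊓-lb₁ 𝟎-min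
sum-⊓-lub {X = X} {y = y} F G (i ∷ is) js h =
  ⊕⊓-lub (go js (h (here ≡.refl))) (sum-⊓-lub F G is js (λ p → h (there p)))
  where
  go : ∀ js → (∀ {j} → j ∈ js → F i ⊓ G j ≤ y) → F i ⊓ sum G js ≤ y
  go []       k = ≤-trans ⊓-lb₂ 𝟎-min
  go (j ∷ js) k = ⊓⊕-lub (k (here ≡.refl)) (go js (λ p → k (there p)))

rev-𝟎 : rev {X} 𝟎 ≡ₑ 𝟎
rev-𝟎 = ≤-antisym
  (≤-trans (rev-mono 𝟎-min) (≤-reflexive (rev-rev 𝟎))) 𝟎-min

-- Reading `𝟏` as `rev (rev 𝟏)` makes `𝟏 ⊙ rev 𝟏` the mirror of itself, and the unit law then
-- applies under the mirror.
rev-𝟏 : rev {X} 𝟏 ≡ₑ 𝟏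
rev-𝟏 = trans (sym (⊙-unitˡ _)) (trans (⊙-cong (sym (rev-rev 𝟏)) refl)
  (trans (sym (rev-⊙ 𝟏 (rev 𝟏))) (trans (rev-cong (⊙-unitˡ _)) (rev-rev 𝟏))))

-- Expressions below `𝟏`.

sub : a ≤ 𝟏 → 𝟏 ⊓ a ≡ₑ a
sub p = ≤-antisym ⊓-lb₂ (⊓-glb p ≤-refl)

sub-comm : a ≤ 𝟏 → ∀ f → a ⊙ f ≡ₑ f ⊙ a
sub-comm {a = a} p f = trans (⊙-cong (sym (sub p)) refl) (trans (ax-comm a f) (⊙-cong refl (sub p)))

sub-⊓ : a ≤ 𝟏 → ∀ f g → (a ⊙ f) ⊓ g ≡ₑ a ⊙ (f ⊓ g)
sub-⊓ {a = a} p f g = trans (⊓-cong (⊙-cong (sym (sub p)) refl) refl)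
  (trans (ax-⊓ a f g) (⊙-cong (sub p) refl))

sub-drop : a ≤ 𝟏 → a ⊙ f ≤ f
sub-drop p = ≤-trans (⊙-mono p ≤-refl) (≤-reflexive (⊙-unitˡ _))

-- Below `𝟏`, `ax-1⊙` trades products for meets, so idempotence of `⊓` becomes duplication of `a`.
sub-dup : a ≤ 𝟏 → a ≤ a ⊙ a
sub-dup {a = a} p = begin
  a             ≤⟨ ⊓-glb p (⊓-glb ≤-refl ≤-refl) ⟩
  𝟏 ⊓ (a ⊓ a)   ≈⟨ ax-1⊙ a a ⟨
  𝟏 ⊓ (a ⊙ a)   ≤⟨ ⊓-lb₂ ⟩
  a ⊙ a         ∎
  where open ≤-Reasoning

sub-rev : a ≤ 𝟏 → rev a ≡ₑ a
sub-rev {a = a} p = trans (sym (sub (≤-trans (rev-mono p) (≤-reflexive rev-𝟏))))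
  (trans (ax-1rev a) (sub p))

sub-split : a ≤ 𝟏 → ∀ x y → a ⊙ (x ⊙ y) ≤ (a ⊙ x) ⊙ (a ⊙ y)
sub-split {a = a} p x y = begin
  a ⊙ (x ⊙ y)          ≤⟨ ⊙-mono (sub-dup p) ≤-refl ⟩
  (a ⊙ a) ⊙ (x ⊙ y)    ≈⟨ ⊙-assoc _ _ _ ⟩
  ((a ⊙ a) ⊙ x) ⊙ y    ≈⟨ ⊙-cong (⊙-assoc a a x) refl ⟨
  (a ⊙ (a ⊙ x)) ⊙ y    ≈⟨ ⊙-cong (sub-comm p _) refl ⟩
  ((a ⊙ x) ⊙ a) ⊙ y    ≈⟨ ⊙-assoc _ _ _ ⟨
  (a ⊙ x) ⊙ (a ⊙ y)    ∎
  where open ≤-Reasoning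

sub-merge : b ≤ 𝟏 → ∀ a x y → (a ⊙ x) ⊙ (b ⊙ y) ≡ₑ (a ⊙ b) ⊙ (x ⊙ y)
sub-merge {b = b} q a x y =
  trans (⊙-assoc _ _ _) (trans (⊙-cong (trans (sym (⊙-assoc a x b))
    (trans (⊙-cong refl (sym (sub-comm q x))) (⊙-assoc a b x))) refl) (sym (⊙-assoc _ _ _)))

-- The instance `g = 𝟎` of `ax-⁺`, read from right to left: one test in front of an iteration is
-- moved into all of its factors.
sub-⁺ : a ≤ 𝟏 → a ⊙ x ⁺ ≤ (a ⊙ x) ⁺
sub-⁺ {a = a} {x = x} p = begin
  a ⊙ x ⁺                             ≤⟨ ⊙-mono (≤-reflexive (sym (sub p))) (⁺-mono ⊕-ub₂) ⟩
  (𝟏 ⊓ a) ⊙ (𝟎 ⊕ x) ⁺                 ≤⟨ ⊕-ub₂ ⟩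
  𝟎 ⁺ ⊕ (𝟏 ⊓ a) ⊙ (𝟎 ⊕ x) ⁺           ≈⟨ ax-⁺ a x 𝟎 ⟨
  (𝟎 ⊕ (𝟏 ⊓ a) ⊙ x) ⁺                 ≤⟨ ⁺-mono (⊕-lub 𝟎-min (≤-reflexive (⊙-cong (sub p) refl))) ⟩
  (a ⊙ x) ⁺                           ∎
  where open ≤-Reasoning

-- Soundness

infix 4 _⊆ₗ_
_⊆ₗ_ : Lang A → Lang A → Set
K ⊆ₗ L = ∀ {w} → K w → L w

∙-map : K ⊆ₗ K' → L ⊆ₗ L' → K ∙ L ⊆ₗ K' ∙ L'
∙-map p q (u , v , eq , k , l) = u , v , eq , p k , q l

∙-assocˡ : K ∙ (L ∙ M) ⊆ₗ (K ∙ L) ∙ M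
∙-assocˡ (u , _ , eq , k , v , w , ≡.refl , l , m) =
  u ++ v , w , ≡.trans eq (≡.sym (++-assoc u v w)) , (u , v , ≡.refl , k , l) , m

∙-assocʳ : (K ∙ L) ∙ M ⊆ₗ K ∙ (L ∙ M)
∙-assocʳ (_ , w , eq , (u , v , ≡.refl , k , l) , m) =
  u , v ++ w , ≡.trans eq (++-assoc u v w) , k , v , w , ≡.refl , l , m

Pow-map : K ⊆ₗ L → ∀ n → Pow K n ⊆ₗ Pow L n
Pow-map p zero    = p
Pow-map p (suc n) = ∙-map p (Pow-map p n)

Pow-snoc : ∀ n → Pow K n ∙ K ⊆ₗ Pow K (suc n)
Pow-snoc zero    p = p
Pow-snoc {K = K} (suc n) p = ∙-map (λ k → k) (Pow-snoc n) (∙-assocʳ {K = K} {L = Pow K n} {M = K} p)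

Pow-unsnoc : ∀ n → Pow K (suc n) ⊆ₗ Pow K n ∙ K
Pow-unsnoc zero    p = p
Pow-unsnoc {K = K} (suc n) p = ∙-assocˡ {K = K} {L = Pow K n} {M = K} (∙-map (λ k → k) (Pow-unsnoc n) p)

∙-rev : (λ w → (K ∙ L) (reverse w)) ⊆ₗ (λ w → L (reverse w)) ∙ (λ w → K (reverse w))
∙-rev {K = K} {L = L} {w = w} (u , v , eq , k , l) =
  reverse v , reverse u
  , ≡.trans (≡.sym (reverse-involutive w)) (≡.trans (≡.cong reverse eq) (reverse-++ u v))
  , ≡.subst L (≡.sym (reverse-involutive v)) l , ≡.subst K (≡.sym (reverse-involutive u)) k

∙-unrev : (λ w → L (reverse w)) ∙ (λ w → K (reverse w)) ⊆ₗ (λ w → (K ∙ L) (reverse w))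
∙-unrev (u , v , ≡.refl , l , k) = reverse v , reverse u , reverse-++ u v , k , l

Pow-rev : ∀ n → (λ w → Pow K n (reverse w)) ⊆ₗ Pow (λ w → K (reverse w)) n
Pow-rev zero    p = p
Pow-rev {K = K} (suc n) p = Pow-snoc n
  (∙-map (Pow-rev n) (λ k → k) (∙-rev {K = K} {L = Pow K n} p))

Pow-unrev : ∀ n → Pow (λ w → K (reverse w)) n ⊆ₗ (λ w → Pow K n (reverse w))
Pow-unrev zero    p = p
Pow-unrev {K = K} (suc n) p = ∙-unrev {L = Pow K n} {K = K}
  (∙-map (Pow-unrev n) (λ k → k) (Pow-unsnoc n p))

Pow-indˡ : K ∙ L ⊆ₗ L → ∀ n → Pow K n ∙ L ⊆ₗ L
Pow-indˡ h zero    p = h p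
Pow-indˡ {K = K} {L = L} h (suc n) p =
  h (∙-map (λ k → k) (Pow-indˡ h n) (∙-assocʳ {K = K} {L = Pow K n} {M = L} p))

Pow-indʳ : L ∙ K ⊆ₗ L → ∀ n → L ∙ Pow K n ⊆ₗ L
Pow-indʳ h zero    p = h p
Pow-indʳ {L = L} {K = K} h (suc n) p =
  Pow-indʳ h n (∙-map h (λ k → k) (∙-assocˡ {K = L} {L = K} {M = Pow K n} p))

guard-out : ∀ (E G F : Lang A) n →
  Pow (λ w → G w ⊎ ((λ v → v ≡ [] × E v) ∙ F) w) n ⊆ₗ
  (λ w → Pow G n w ⊎ (E [] × Pow (λ v → G v ⊎ F v) n w))
guard-out E G F zero (inj₁ p) = inj₁ p
guard-out E G F zero (inj₂ (_ , _ , ≡.refl , (≡.refl , p) , q)) = inj₂ (p , inj₂ q)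
guard-out E G F (suc n) (u , v , eq , p , q) with p | guard-out E G F n q
... | inj₁ p | inj₁ q = inj₁ (u , v , eq , p , q)
... | inj₁ p | inj₂ (ε , q) = inj₂ (ε , u , v , eq , inj₁ p , q)
... | inj₂ (_ , _ , ≡.refl , (≡.refl , ε) , p) | inj₁ q = inj₂ (ε , u , v , eq , inj₂ p , Pow-map inj₁ n q)
... | inj₂ (_ , _ , ≡.refl , (≡.refl , _) , p) | inj₂ (ε , q) = inj₂ (ε , u , v , eq , inj₂ p , q)

module _ {X A : Set} (σ : X → Lang A) where
  -- The two inclusions are proved together because `sym` exchanges them. The premise of an
  -- induction rule is used as an inclusion, which `Pow-indˡ` or `Pow-indʳ` iterates.
  sound-⊆ : ∀ {e f} → e ≡ₑ f → ⟦ e ⟧ σ ⊆ₗ ⟦ f ⟧ σ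
  sound-⊇ : ∀ {e f} → e ≡ₑ f → ⟦ f ⟧ σ ⊆ₗ ⟦ e ⟧ σ

  sound-⊆ refl p = p
  sound-⊆ (sym d) p = sound-⊇ d p
  sound-⊆ (trans d d') p = sound-⊆ d' (sound-⊆ d p)
  sound-⊆ (⊕-cong d d') (inj₁ p) = inj₁ (sound-⊆ d p)
  sound-⊆ (⊕-cong d d') (inj₂ p) = inj₂ (sound-⊆ d' p)
  sound-⊆ (⊙-cong d d') p = ∙-map (sound-⊆ d) (sound-⊆ d') p
  sound-⊆ (⊓-cong d d') (p , q) = sound-⊆ d p , sound-⊆ d' q
  sound-⊆ (⁺-cong d) (n , p) = n , Pow-map (sound-⊆ d) n p
  sound-⊆ (rev-cong d) p = sound-⊆ d p
  sound-⊆ (⊕-comm e f) (inj₁ p) = inj₂ p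
  sound-⊆ (⊕-comm e f) (inj₂ p) = inj₁ p
  sound-⊆ (⊕-assoc e f g) (inj₁ p) = inj₁ (inj₁ p)
  sound-⊆ (⊕-assoc e f g) (inj₂ (inj₁ p)) = inj₁ (inj₂ p)
  sound-⊆ (⊕-assoc e f g) (inj₂ (inj₂ p)) = inj₂ p
  sound-⊆ (⊕-zero e) (inj₁ p) = p
  sound-⊆ (⊓-comm e f) (p , q) = q , p
  sound-⊆ (⊓-idem e) (p , _) = p
  sound-⊆ (⊓-assoc e f g) (p , q , r) = (p , q) , r
  sound-⊆ (⊓-distr e f g) (inj₁ p , q) = inj₁ (p , q)
  sound-⊆ (⊓-distr e f g) (inj₂ p , q) = inj₂ (p , q)
  sound-⊆ (absorb e f) (inj₁ (p , _)) = p
  sound-⊆ (absorb e f) (inj₂ p) = p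
  sound-⊆ (⊙-assoc e f g) p = ∙-assocˡ {K = ⟦ e ⟧ σ} {L = ⟦ f ⟧ σ} {M = ⟦ g ⟧ σ} p
  sound-⊆ (⊙-zeroʳ e) (_ , _ , _ , _ , ())
  sound-⊆ (⊙-zeroˡ e) (_ , _ , _ , () , _)
  sound-⊆ (⊙-distrʳ e f g) (u , v , eq , inj₁ p , q) = inj₁ (u , v , eq , p , q)
  sound-⊆ (⊙-distrʳ e f g) (u , v , eq , inj₂ p , q) = inj₂ (u , v , eq , p , q)
  sound-⊆ (⊙-distrˡ e f g) (u , v , eq , p , inj₁ q) = inj₁ (u , v , eq , p , q)
  sound-⊆ (⊙-distrˡ e f g) (u , v , eq , p , inj₂ q) = inj₂ (u , v , eq , p , q)
  sound-⊆ (⁺-unfoldˡ e) (zero , p) = inj₁ p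
  sound-⊆ (⁺-unfoldˡ e) (suc n , u , v , eq , p , q) = inj₂ (u , v , eq , p , n , q)
  sound-⊆ (⁺-unfoldʳ e) (zero , p) = inj₁ p
  sound-⊆ (⁺-unfoldʳ e) (suc n , p) = inj₂ (∙-map (n ,_) (λ q → q) (Pow-unsnoc n p))
  sound-⊆ (rev-rev e) {w} p = ≡.subst (⟦ e ⟧ σ) (reverse-involutive w) p
  sound-⊆ (rev-⊕ e f) p = p
  sound-⊆ (rev-⊙ e f) p = ∙-rev {K = ⟦ e ⟧ σ} {L = ⟦ f ⟧ σ} p
  sound-⊆ (rev-⊓ e f) p = p
  sound-⊆ (rev-⁺ e) (n , p) = n , Pow-rev n p
  sound-⊆ (⊙-unitˡ e) (_ , _ , ≡.refl , ≡.refl , p) = p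
  sound-⊆ (⊙-unitʳ e) (u , _ , ≡.refl , p , ≡.refl) = ≡.subst (⟦ e ⟧ σ) (≡.sym (++-identityʳ u)) p
  sound-⊆ (ax-1⊙ e f) (≡.refl , [] , [] , eq , p , q) = ≡.refl , p , q
  sound-⊆ (ax-1rev e) (≡.refl , p) = ≡.refl , p
  sound-⊆ (ax-comm e f) (_ , v , ≡.refl , (≡.refl , p) , q) =
    v , [] , ≡.sym (++-identityʳ v) , q , ≡.refl , p
  sound-⊆ (ax-⊓ e f g) (([] , v , ≡.refl , (≡.refl , p) , q) , r) = [] , v , ≡.refl , (≡.refl , p) , q , r
  sound-⊆ (ax-⁺ e f g) (n , p) with guard-out (⟦ e ⟧ σ) (⟦ g ⟧ σ) (⟦ f ⟧ σ) n p
  ... | inj₁ q = inj₁ (n , q)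
  ... | inj₂ (ε , q) = inj₂ ([] , _ , ≡.refl , (≡.refl , ε) , n , q)
  sound-⊆ (ind-ˡ d) (inj₁ (u , v , eq , (n , p) , q)) =
    Pow-indˡ (λ r → sound-⊆ d (inj₁ r)) n (u , v , eq , p , q)
  sound-⊆ (ind-ˡ d) (inj₂ p) = p
  sound-⊆ (ind-ʳ d) (inj₁ (u , v , eq , p , n , q)) =
    Pow-indʳ (λ r → sound-⊆ d (inj₁ r)) n (u , v , eq , p , q)
  sound-⊆ (ind-ʳ d) (inj₂ p) = p

  sound-⊇ refl p = p
  sound-⊇ (sym d) p = sound-⊆ d p
  sound-⊇ (trans d d') p = sound-⊇ d (sound-⊇ d' p)
  sound-⊇ (⊕-cong d d') (inj₁ p) = inj₁ (sound-⊇ d p)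
  sound-⊇ (⊕-cong d d') (inj₂ p) = inj₂ (sound-⊇ d' p)
  sound-⊇ (⊙-cong d d') p = ∙-map (sound-⊇ d) (sound-⊇ d') p
  sound-⊇ (⊓-cong d d') (p , q) = sound-⊇ d p , sound-⊇ d' q
  sound-⊇ (⁺-cong d) (n , p) = n , Pow-map (sound-⊇ d) n p
  sound-⊇ (rev-cong d) p = sound-⊇ d p
  sound-⊇ (⊕-comm e f) (inj₁ p) = inj₂ p
  sound-⊇ (⊕-comm e f) (inj₂ p) = inj₁ p
  sound-⊇ (⊕-assoc e f g) (inj₁ (inj₁ p)) = inj₁ p
  sound-⊇ (⊕-assoc e f g) (inj₁ (inj₂ p)) = inj₂ (inj₁ p)
  sound-⊇ (⊕-assoc e f g) (inj₂ p) = inj₂ (inj₂ p)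
  sound-⊇ (⊕-zero e) p = inj₁ p
  sound-⊇ (⊓-comm e f) (p , q) = q , p
  sound-⊇ (⊓-idem e) p = p , p
  sound-⊇ (⊓-assoc e f g) ((p , q) , r) = p , q , r
  sound-⊇ (⊓-distr e f g) (inj₁ (p , q)) = inj₁ p , q
  sound-⊇ (⊓-distr e f g) (inj₂ (p , q)) = inj₂ p , q
  sound-⊇ (absorb e f) p = inj₂ p
  sound-⊇ (⊙-assoc e f g) p = ∙-assocʳ {K = ⟦ e ⟧ σ} {L = ⟦ f ⟧ σ} {M = ⟦ g ⟧ σ} p
  sound-⊇ (⊙-distrʳ e f g) (inj₁ p) = ∙-map inj₁ (λ q → q) p
  sound-⊇ (⊙-distrʳ e f g) (inj₂ p) = ∙-map inj₂ (λ q → q) p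
  sound-⊇ (⊙-distrˡ e f g) (inj₁ p) = ∙-map (λ q → q) inj₁ p
  sound-⊇ (⊙-distrˡ e f g) (inj₂ p) = ∙-map (λ q → q) inj₂ p
  sound-⊇ (⁺-unfoldˡ e) (inj₁ p) = zero , p
  sound-⊇ (⁺-unfoldˡ e) (inj₂ (u , v , eq , p , n , q)) = suc n , u , v , eq , p , q
  sound-⊇ (⁺-unfoldʳ e) (inj₁ p) = zero , p
  sound-⊇ (⁺-unfoldʳ e) (inj₂ (u , v , eq , (n , p) , q)) = suc n , Pow-snoc n (u , v , eq , p , q)
  sound-⊇ (rev-rev e) {w} p = ≡.subst (⟦ e ⟧ σ) (≡.sym (reverse-involutive w)) p
  sound-⊇ (rev-⊕ e f) p = p
  sound-⊇ (rev-⊙ e f) p = ∙-unrev {L = ⟦ f ⟧ σ} {K = ⟦ e ⟧ σ} p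
  sound-⊇ (rev-⊓ e f) p = p
  sound-⊇ (rev-⁺ e) (n , p) = n , Pow-unrev n p
  sound-⊇ (⊙-unitˡ e) {w} p = [] , w , ≡.refl , ≡.refl , p
  sound-⊇ (⊙-unitʳ e) {w} p = w , [] , ≡.sym (++-identityʳ w) , p , ≡.refl
  sound-⊇ (ax-1⊙ e f) (≡.refl , p , q) = ≡.refl , [] , [] , ≡.refl , p , q
  sound-⊇ (ax-1rev e) (≡.refl , p) = ≡.refl , p
  sound-⊇ (ax-comm e f) (u , _ , ≡.refl , p , ≡.refl , q) =
    [] , u , ++-identityʳ u , (≡.refl , q) , p
  sound-⊇ (ax-⊓ e f g) ([] , v , ≡.refl , (≡.refl , p) , q , r) = ([] , v , ≡.refl , (≡.refl , p) , q) , r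
  sound-⊇ (ax-⁺ e f g) (inj₁ (n , p)) = n , Pow-map inj₁ n p
  sound-⊇ (ax-⁺ e f g) (inj₂ (_ , _ , ≡.refl , (≡.refl , ε) , n , p)) = n , Pow-map guarded n p
    where
    guarded : ⟦ g ⊕ f ⟧ σ ⊆ₗ ⟦ g ⊕ (𝟏 ⊓ e) ⊙ f ⟧ σ
    guarded (inj₁ q) = inj₁ q
    guarded (inj₂ q) = inj₂ ([] , _ , ≡.refl , (≡.refl , ε) , q)
  sound-⊇ (ind-ˡ d) p = inj₂ p
  sound-⊇ (ind-ʳ d) p = inj₂ p

soundness : ∀ {X} {e f : Exp X} → e ≡ₑ f → e ≃ f
soundness d A σ w = mk⇔ (sound-⊆ σ d) (sound-⊇ σ d)

-- Identity-free expressions and series-parallel graphs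

powerset : {A : Set} → List A → List (List A)
powerset []       = [] ∷ []
powerset (x ∷ xs) = map (x ∷_) (powerset xs) ++ powerset xs

filter∈powerset : {A : Set} {P : A → Set} (P? : ∀ x → Dec (P x)) (xs : List A) →
  filter P? xs ∈ powerset xs
filter∈powerset P? [] = here ≡.refl
filter∈powerset P? (x ∷ xs) with P? x
... | yes _ = ∈-++⁺ˡ (∈-map⁺ (x ∷_) (filter∈powerset P? xs))
... | no _  = ∈-++⁺ʳ (map (x ∷_) (powerset xs)) (filter∈powerset P? xs)

infixl 5 _∪_
infixl 6 _∩_
infixl 7 _⨾_
infix 9 _^+

data IExp (L : Set) : Set where
  lit : L → IExp L
  ∅   : IExp L
  _∪_ _⨾_ _∩_ : IExp L → IExp L → IExp L
  _^+ : IExp L → IExp L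

Iter : (ℕ → ℕ → Set) → ℕ → ℕ → ℕ → Set
Iter R zero    i j = R i j
Iter R (suc n) i j = ∃ λ k → R i k × Iter R n k j

module _ {L : Set} where
  Holds : (L → ℕ → ℕ → Set) → IExp L → ℕ → ℕ → Set
  Holds E (lit l) i j = E l i j
  Holds E ∅       i j = ⊥
  Holds E (g ∪ h) i j = Holds E g i j ⊎ Holds E h i j
  Holds E (g ⨾ h) i j = ∃ λ k → Holds E g i k × Holds E h k j
  Holds E (g ∩ h) i j = Holds E g i j × Holds E h i j
  Holds E (g ^+)  i j = ∃ λ n → Iter (Holds E g) n i j

infixl 7 _⨟_
infixl 6 _∥_

data SP (L : Set) : Set where
  atom    : L → SP L
  _⨟_ _∥_ : SP L → SP L → SP L

module _ {L : Set} where
  -- A homomorphism from the graph `u` into the labelled graph `E` that sends the source to `i` and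
  -- the target to `j`.
  Placed : (L → ℕ → ℕ → Set) → SP L → ℕ → ℕ → Set
  Placed E (atom l) i j = E l i j
  Placed E (u ⨟ v)  i j = ∃ λ k → Placed E u i k × Placed E v k j
  Placed E (u ∥ v)  i j = Placed E u i j × Placed E v i j

  Realises : SP L → IExp L → Set₁
  Realises u g = ∀ E i j → Placed E u i j → Holds E g i j

  -- Cut A u x y: the graph u can be cut into an initial part x, a (possibly
  -- empty) chain of parts satisfying A, and a final part y.
  data Cut (A : SP L → Set) : SP L → SP L → SP L → Set where
    -- The cut passes through a node inside one branch; no path through that node uses the other
    -- branch, which is dropped.
    parˡ  : ∀ {u v x y} → Cut A u x y → Cut A (u ∥ v) x y
    parʳ  : ∀ {u v x y} → Cut A v x y → Cut A (u ∥ v) x y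
    mid   : ∀ {u v} → Cut A (u ⨟ v) u v
    seqˡ  : ∀ {u v x y} → Cut A u x y → Cut A (u ⨟ v) x (y ⨟ v)
    seqʳ  : ∀ {u v x y} → Cut A v x y → Cut A (u ⨟ v) (u ⨟ x) y
    skipˡ : ∀ {u v x y} → Cut A u x y → A y → Cut A (u ⨟ v) x v
    skipʳ : ∀ {u v x y} → Cut A v x y → A x → Cut A (u ⨟ v) u y
    -- The chain crosses the junction of `u` and `v`: either one part straddles it, or the junction
    -- is a boundary between two parts.
    skip  : ∀ {u v x y x' y'} → Cut A u x y → Cut A v x' y' →
            A (y ⨟ x') ⊎ (A y × A x') → Cut A (u ⨟ v) x y'

  Split : SP L → SP L → SP L → Set
  Split = Cut (λ _ → ⊥)

  module _ {A : SP L → Set} (A? : ∀ u → Dec (A u)) where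
    -- The predicate is arbitrary so that a recursive call can put the surrounding graph back into
    -- it; for `skip` it is itself a search through the other factor.
    anyCut? : ∀ {P : SP L → SP L → Set} → (∀ x y → Dec (P x y)) → ∀ u →
              Dec (∃₂ λ x y → Cut A u x y × P x y)
    anyCut? P? (atom l) = no λ { (_ , _ , () , _) }
    anyCut? P? (u ∥ v) = map′
      (λ { (inj₁ (x , y , c , p)) → x , y , parˡ c , p
         ; (inj₂ (x , y , c , p)) → x , y , parʳ c , p })
      (λ { (x , y , parˡ c , p) → inj₁ (x , y , c , p)
         ; (x , y , parʳ c , p) → inj₂ (x , y , c , p) })
      (anyCut? P? u ⊎-dec anyCut? P? v)
    anyCut? P? (u ⨟ v) = map′
      (λ { (inj₁ p) → u , v , mid , p
         ; (inj₂ (inj₁ (x , y , c , p))) → x , y ⨟ v , seqˡ c , p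
         ; (inj₂ (inj₂ (inj₁ (x , y , c , p)))) → u ⨟ x , y , seqʳ c , p
         ; (inj₂ (inj₂ (inj₂ (inj₁ (x , y , c , a , p))))) → x , v , skipˡ c a , p
         ; (inj₂ (inj₂ (inj₂ (inj₂ (inj₁ (x , y , c , a , p)))))) → u , y , skipʳ c a , p
         ; (inj₂ (inj₂ (inj₂ (inj₂ (inj₂ (x , y , c , x' , y' , c' , a , p)))))) → x , y' , skip c c' a , p })
      (λ { (_ , _ , mid , p) → inj₁ p
         ; (_ , _ , seqˡ c , p) → inj₂ (inj₁ (_ , _ , c , p))
         ; (_ , _ , seqʳ c , p) → inj₂ (inj₂ (inj₁ (_ , _ , c , p)))
         ; (_ , _ , skipˡ c a , p) → inj₂ (inj₂ (inj₂ (inj₁ (_ , _ , c , a , p))))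
         ; (_ , _ , skipʳ c a , p) → inj₂ (inj₂ (inj₂ (inj₂ (inj₁ (_ , _ , c , a , p)))))
         ; (_ , _ , skip c c' a , p) → inj₂ (inj₂ (inj₂ (inj₂ (inj₂ (_ , _ , c , _ , _ , c' , a , p))))) })
      (P? u v
       ⊎-dec anyCut? (λ x y → P? x (y ⨟ v)) u
       ⊎-dec anyCut? (λ x y → P? (u ⨟ x) y) v
       ⊎-dec anyCut? (λ x y → A? y ×-dec P? x v) u
       ⊎-dec anyCut? (λ x y → A? x ×-dec P? u y) v
       ⊎-dec anyCut? (λ x y → anyCut? (λ x' y' →
               (A? (y ⨟ x') ⊎-dec (A? y ×-dec A? x')) ×-dec P? x y') v) u)

  split⇒cut : ∀ {A u x y} → Split u x y → Cut A u x y
  split⇒cut (parˡ c) = parˡ (split⇒cut c)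
  split⇒cut (parʳ c) = parʳ (split⇒cut c)
  split⇒cut mid      = mid
  split⇒cut (seqˡ c) = seqˡ (split⇒cut c)
  split⇒cut (seqʳ c) = seqʳ (split⇒cut c)
  split⇒cut (skip c c' (inj₁ ()))
  split⇒cut (skip c c' (inj₂ ()))

  -- The part `z` becomes one more link of the chain. Iterating this compresses a `Chain` of any
  -- length into a single cut, of which a type has to remember only the two ends.
  split-cut : ∀ {A u x y z w} → Split u x y → Cut A y z w → A z → Cut A u x w
  split-cut (parˡ s) c a = parˡ (split-cut s c a)
  split-cut (parʳ s) c a = parʳ (split-cut s c a)
  split-cut mid c a = skipʳ c a
  split-cut (seqˡ s) mid a = skipˡ (split⇒cut s) a
  split-cut (seqˡ s) (seqˡ c) a = seqˡ (split-cut s c a)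
  split-cut (seqˡ s) (seqʳ c) a = skip (split⇒cut s) c (inj₁ a)
  split-cut (seqˡ s) (skipˡ c b) a = skipˡ (split-cut s c a) b
  split-cut (seqˡ s) (skipʳ c b) a = skip (split⇒cut s) c (inj₂ (a , b))
  split-cut (seqˡ s) (skip c c' b) a = skip (split-cut s c a) c' b
  split-cut (seqʳ s) c a = seqʳ (split-cut s c a)
  split-cut (skip s s' (inj₁ ())) c a
  split-cut (skip s s' (inj₂ ())) c a

  Edge : SP L → L → Set
  Edge (atom k) l = k ≡ l
  Edge (u ⨟ v)  l = ⊥
  Edge (u ∥ v)  l = Edge u l ⊎ Edge v l

  Chain : (SP L → Set) → ℕ → SP L → Set
  Chain P zero    u = P u
  Chain P (suc n) u = ∃₂ λ x y → Split u x y × P x × Chain P n y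

  infix 4 _⊨_
  -- Stands for truth in the graph `u` itself: `holds⇒⊨` derives it from truth between the ends of
  -- any layout of `u`.
  _⊨_ : SP L → IExp L → Set
  u ⊨ lit l = Edge u l
  u ⊨ ∅     = ⊥
  u ⊨ g ∪ h = u ⊨ g ⊎ u ⊨ h
  u ⊨ g ⨾ h = ∃₂ λ x y → Split u x y × x ⊨ g × y ⊨ h
  u ⊨ g ∩ h = u ⊨ g × u ⊨ h
  u ⊨ g ^+  = ∃ λ n → Chain (_⊨ g) n u

-- Finite typings and recognisers of identity-free expressions.

module Completeness {X L : Set} (_≟_ : DecidableEquality L) (letterᴱ : L → Exp X)
  (Z : Exp X) (letter≤Z : ∀ l → letterᴱ l ≤ Z) (Z⊙Z≤Z : Z ⊙ Z ≤ Z) where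

  ⌊_⌋ : IExp L → Exp X
  ⌊ lit l ⌋ = letterᴱ l
  ⌊ ∅ ⌋     = 𝟎
  ⌊ g ∪ h ⌋ = ⌊ g ⌋ ⊕ ⌊ h ⌋
  ⌊ g ⨾ h ⌋ = ⌊ g ⌋ ⊙ ⌊ h ⌋
  ⌊ g ∩ h ⌋ = ⌊ g ⌋ ⊓ ⌊ h ⌋
  ⌊ g ^+ ⌋  = ⌊ g ⌋ ⁺

  -- The inequalities are lax: a composite of bounds only has to lie below the bound of the
  -- composite graph. This leaves room for bounds that are meets.
  record Types : Set₁ where
    field
      Ty     : Set
      _≟ᵀ_   : DecidableEquality Ty
      types  : List Ty
      ty     : SP L → Ty
      ty∈    : ∀ u → ty u ∈ types
      bound  : Ty → Exp X

    ⌈_⌉ : SP L → Exp X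
    ⌈ u ⌉ = bound (ty u)

    field
      bound-atom : ∀ l → letterᴱ l ≤ ⌈ atom l ⌉
      bound-⨟    : ∀ u v → ⌈ u ⌉ ⊙ ⌈ v ⌉ ≤ ⌈ u ⨟ v ⌉
      bound-∥    : ∀ u v → ⌈ u ⌉ ⊓ ⌈ v ⌉ ≤ ⌈ u ∥ v ⌉

  -- `Acc` is a decidable stand-in for `_⊨ f`, which quantifies over chains of arbitrary length at
  -- each `^+`. By `complete` a rejected graph is a counterexample, by `sound` an accepted one is a
  -- summand below `⌊ f ⌋`.
  record Recogniser (f : IExp L) : Set₁ where
    field
      typing   : Types
    open Types typing public
    field
      Acc      : SP L → Set
      Acc?     : ∀ u → Dec (Acc u)
      complete : ∀ {u} → u ⊨ f → Acc u
      sound    : ∀ {u} → Acc u → ⌈ u ⌉ ≤ ⌊ f ⌋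

  edge? : ∀ u l → Dec (Edge u l)
  edge? (atom k) l = k ≟ l
  edge? (u ⨟ v)  l = no λ ()
  edge? (u ∥ v)  l = edge? u l ⊎-dec edge? v l

  -- `Z` acts as a greatest identity-free expression, so the type `false` claims nothing about the
  -- graph.
  litTypes : L → Types
  litTypes l = record
    { Ty = Bool ; _≟ᵀ_ = Data.Bool._≟_ ; types = true ∷ false ∷ []
    ; ty = ty ; ty∈ = λ u → ty∈ (ty u) ; bound = bound
    ; bound-atom = bound-atom ; bound-⨟ = bound-⨟ ; bound-∥ = bound-∥ }
    where
    ty : SP L → Bool
    ty u = Dec.does (edge? u l)
    bound : Bool → Exp X
    bound true  = letterᴱ l
    bound false = Z
    ty∈ : ∀ b → b ∈ true ∷ false ∷ []
    ty∈ true  = here ≡.refl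
    ty∈ false = there (here ≡.refl)
    bound≤Z : ∀ b → bound b ≤ Z
    bound≤Z true  = letter≤Z l
    bound≤Z false = ≤-refl
    bound-atom : ∀ k → letterᴱ k ≤ bound (ty (atom k))
    bound-atom k with k ≟ l
    ... | yes ≡.refl = ≤-refl
    ... | no _       = letter≤Z k
    bound-⨟ : ∀ u v → bound (ty u) ⊙ bound (ty v) ≤ Z
    bound-⨟ u v = ≤-trans (⊙-mono (bound≤Z (ty u)) (bound≤Z (ty v))) Z⊙Z≤Z
    bound-∥ : ∀ u v → bound (ty u) ⊓ bound (ty v) ≤ bound (ty (u ∥ v))
    bound-∥ u v with edge? u l | edge? v l
    ... | yes _ | yes _ = ⊓-lb₁
    ... | yes _ | no _  = ⊓-lb₁
    ... | no _  | yes _ = ⊓-lb₂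
    ... | no _  | no _  = ⊓-lb₁

  litRecogniser : ∀ l → Recogniser (lit l)
  litRecogniser l = record
    { typing = litTypes l
    ; Acc = λ u → Edge u l ; Acc? = λ u → edge? u l
    ; complete = λ p → p ; sound = sound }
    where
    sound : ∀ {u} → Edge u l → Types.⌈_⌉ (litTypes l) u ≤ letterᴱ l
    sound {u} p with edge? u l
    ... | yes _ = ≤-refl
    ... | no ¬p = contradiction p ¬p

  ∅Recogniser : Recogniser ∅
  ∅Recogniser = record
    { typing = record
      { Ty = ⊤ ; _≟ᵀ_ = λ _ _ → yes ≡.refl ; types = tt ∷ [] ; ty = λ _ → tt
      ; ty∈ = λ _ → here ≡.refl ; bound = λ _ → Z
      ; bound-atom = letter≤Z ; bound-⨟ = λ _ _ → Z⊙Z≤Z ; bound-∥ = λ _ _ → ⊓-lb₁ }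
    ; Acc = λ _ → ⊥ ; Acc? = λ _ → no λ () ; complete = λ p → p ; sound = λ () }

  module _ (𝒯₁ 𝒯₂ : Types) where
    private
      module T₁ = Types 𝒯₁
      module T₂ = Types 𝒯₂

    pairTypes : Types
    pairTypes = record
      { Ty = T₁.Ty × T₂.Ty ; _≟ᵀ_ = ×-≡-dec T₁._≟ᵀ_ T₂._≟ᵀ_
      ; types = cartesianProduct T₁.types T₂.types
      ; ty = λ u → T₁.ty u , T₂.ty u
      ; ty∈ = λ u → ∈-cartesianProduct⁺ (T₁.ty∈ u) (T₂.ty∈ u)
      ; bound = λ (r , s) → T₁.bound r ⊓ T₂.bound s
      ; bound-atom = λ l → ⊓-glb (T₁.bound-atom l) (T₂.bound-atom l)
      ; bound-⨟ = λ u v → ⊓-glb (≤-trans (⊙-mono ⊓-lb₁ ⊓-lb₁) (T₁.bound-⨟ u v))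
                                (≤-trans (⊙-mono ⊓-lb₂ ⊓-lb₂) (T₂.bound-⨟ u v))
      ; bound-∥ = λ u v → ⊓-glb (≤-trans (⊓-mono ⊓-lb₁ ⊓-lb₁) (T₁.bound-∥ u v))
                                (≤-trans (⊓-mono ⊓-lb₂ ⊓-lb₂) (T₂.bound-∥ u v)) }

    -- `c` bounds the chain between the ends of a cut: `𝟏` for `⨾`, where the chain is empty, and
    -- `𝟏 ⊕ ⌊ f ⌋ ⁺` for `^+`. The three absorption hypotheses let `c` swallow the parts that
    -- `skipˡ`, `skipʳ` and `skip`, in this order, hand over to the chain.
    module CutTypes (c : Exp X) (𝟏≤c : 𝟏 ≤ c) {A : SP L → Set} (A? : ∀ u → Dec (A u))
      (absorbʳ : ∀ {y} → A y → c ⊙ T₂.⌈ y ⌉ ≤ c)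
      (absorbˡ : ∀ {x} → A x → T₁.⌈ x ⌉ ⊙ c ≤ c)
      (absorbᵐ : ∀ {y x} → A (y ⨟ x) ⊎ (A y × A x) → c ⊙ (T₂.⌈ y ⌉ ⊙ (T₁.⌈ x ⌉ ⊙ c)) ≤ c) where

      Ty : Set
      Ty = (T₁.Ty × T₂.Ty) × List (T₁.Ty × T₂.Ty)

      through : T₁.Ty × T₂.Ty → Exp X
      through (r , s) = T₁.bound r ⊙ (c ⊙ T₂.bound s)

      -- The base `T₁.bound r ⊓ T₂.bound s` is for a graph that lies wholly inside the first or the
      -- last part of a cut of a larger graph.
      bound : Ty → Exp X
      bound ((r , s) , ps) = foldr (λ p z → through p ⊓ z) (T₁.bound r ⊓ T₂.bound s) ps

      pairs : List (T₁.Ty × T₂.Ty)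
      pairs = cartesianProduct T₁.types T₂.types

      cut? : ∀ u (p : T₁.Ty × T₂.Ty) → Dec (∃₂ λ x y → Cut A u x y × (T₁.ty x , T₂.ty y) ≡ p)
      cut? u p = anyCut? A? (λ x y → ×-≡-dec T₁._≟ᵀ_ T₂._≟ᵀ_ (T₁.ty x , T₂.ty y) p) u

      -- Filtering one fixed list gives the set of pairs a canonical form: it lies in
      -- `powerset pairs`, and types are compared as lists.
      ty : SP L → Ty
      ty u = (T₁.ty u , T₂.ty u) , filter (cut? u) pairs

      bound-base : ∀ r s ps → bound ((r , s) , ps) ≤ T₁.bound r ⊓ T₂.bound s
      bound-base r s []       = ≤-refl
      bound-base r s (_ ∷ ps) = ≤-trans ⊓-lb₂ (bound-base r s ps)

      bound-∈ : ∀ q {p ps} → p ∈ ps → bound (q , ps) ≤ through p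
      bound-∈ q (here ≡.refl) = ⊓-lb₁
      bound-∈ q (there i)     = ≤-trans ⊓-lb₂ (bound-∈ q i)

      bound-glb : ∀ {z} r s ps → z ≤ T₁.bound r ⊓ T₂.bound s →
        (∀ {p} → p ∈ ps → z ≤ through p) → z ≤ bound ((r , s) , ps)
      bound-glb r s []       h k = h
      bound-glb r s (p ∷ ps) h k = ⊓-glb (k (here ≡.refl)) (bound-glb r s ps h (λ i → k (there i)))

      ≤₁ : ∀ u → bound (ty u) ≤ T₁.⌈ u ⌉
      ≤₁ u = ≤-trans (bound-base (T₁.ty u) (T₂.ty u) (filter (cut? u) pairs)) ⊓-lb₁

      ≤₂ : ∀ u → bound (ty u) ≤ T₂.⌈ u ⌉
      ≤₂ u = ≤-trans (bound-base (T₁.ty u) (T₂.ty u) (filter (cut? u) pairs)) ⊓-lb₂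

      ≤cut : ∀ {u x y} → Cut A u x y → bound (ty u) ≤ T₁.⌈ x ⌉ ⊙ (c ⊙ T₂.⌈ y ⌉)
      ≤cut {u} {x} {y} d = bound-∈ _
        (∈-filter⁺ (cut? u) (∈-cartesianProduct⁺ (T₁.ty∈ x) (T₂.ty∈ y)) (x , y , d , ≡.refl))

      glb : ∀ {z} u → z ≤ T₁.⌈ u ⌉ → z ≤ T₂.⌈ u ⌉ →
        (∀ {x y} → Cut A u x y → z ≤ T₁.⌈ x ⌉ ⊙ (c ⊙ T₂.⌈ y ⌉)) → z ≤ bound (ty u)
      glb {z} u p q h = bound-glb _ _ _ (⊓-glb p q) λ i → go (proj₂ (∈-filter⁻ (cut? u) {xs = pairs} i))
        where
        go : ∀ {p} → (∃₂ λ x y → Cut A u x y × (T₁.ty x , T₂.ty y) ≡ p) → z ≤ through p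
        go (x , y , d , ≡.refl) = h d

      -- Since `bound` is a meet, each cut of `u ⨟ v` is treated on its own, and its constructor
      -- tells which cuts of `u` and `v` bound the two factors.
      bound-⨟ : ∀ u v → bound (ty u) ⊙ bound (ty v) ≤ bound (ty (u ⨟ v))
      bound-⨟ u v = glb (u ⨟ v)
        (≤-trans (⊙-mono (≤₁ u) (≤₁ v)) (T₁.bound-⨟ u v))
        (≤-trans (⊙-mono (≤₂ u) (≤₂ v)) (T₂.bound-⨟ u v))
        cut
        where
        open ≤-Reasoning
        cut : ∀ {x y} → Cut A (u ⨟ v) x y → bound (ty u) ⊙ bound (ty v) ≤ T₁.⌈ x ⌉ ⊙ (c ⊙ T₂.⌈ y ⌉)
        cut mid = ⊙-mono (≤₁ u) (begin
          bound (ty v)       ≤⟨ ≤₂ v ⟩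
          T₂.⌈ v ⌉           ≈⟨ ⊙-unitˡ _ ⟨
          𝟏 ⊙ T₂.⌈ v ⌉       ≤⟨ ⊙-mono 𝟏≤c ≤-refl ⟩
          c ⊙ T₂.⌈ v ⌉       ∎)
        cut (seqˡ {x = x} {y = y} d) = begin
          bound (ty u) ⊙ bound (ty v)                ≤⟨ ⊙-mono (≤cut d) (≤₂ v) ⟩
          (T₁.⌈ x ⌉ ⊙ (c ⊙ T₂.⌈ y ⌉)) ⊙ T₂.⌈ v ⌉      ≈⟨ ⊙-assoc _ _ _ ⟨
          T₁.⌈ x ⌉ ⊙ ((c ⊙ T₂.⌈ y ⌉) ⊙ T₂.⌈ v ⌉)      ≈⟨ ⊙-cong refl (⊙-assoc _ _ _) ⟨
          T₁.⌈ x ⌉ ⊙ (c ⊙ (T₂.⌈ y ⌉ ⊙ T₂.⌈ v ⌉))      ≤⟨ ⊙-mono ≤-refl (⊙-mono ≤-refl (T₂.bound-⨟ y v)) ⟩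
          T₁.⌈ x ⌉ ⊙ (c ⊙ T₂.⌈ y ⨟ v ⌉)               ∎
        cut (seqʳ {x = x} {y = y} d) = begin
          bound (ty u) ⊙ bound (ty v)                ≤⟨ ⊙-mono (≤₁ u) (≤cut d) ⟩
          T₁.⌈ u ⌉ ⊙ (T₁.⌈ x ⌉ ⊙ (c ⊙ T₂.⌈ y ⌉))      ≈⟨ ⊙-assoc _ _ _ ⟩
          (T₁.⌈ u ⌉ ⊙ T₁.⌈ x ⌉) ⊙ (c ⊙ T₂.⌈ y ⌉)      ≤⟨ ⊙-mono (T₁.bound-⨟ u x) ≤-refl ⟩
          T₁.⌈ u ⨟ x ⌉ ⊙ (c ⊙ T₂.⌈ y ⌉)               ∎
        cut (skipˡ {x = x} {y = y} d a) = begin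
          bound (ty u) ⊙ bound (ty v)                ≤⟨ ⊙-mono (≤cut d) (≤₂ v) ⟩
          (T₁.⌈ x ⌉ ⊙ (c ⊙ T₂.⌈ y ⌉)) ⊙ T₂.⌈ v ⌉      ≤⟨ ⊙-mono (⊙-mono ≤-refl (absorbʳ a)) ≤-refl ⟩
          (T₁.⌈ x ⌉ ⊙ c) ⊙ T₂.⌈ v ⌉                   ≈⟨ ⊙-assoc _ _ _ ⟨
          T₁.⌈ x ⌉ ⊙ (c ⊙ T₂.⌈ v ⌉)                   ∎
        cut (skipʳ {x = x} {y = y} d a) = begin
          bound (ty u) ⊙ bound (ty v)                ≤⟨ ⊙-mono (≤₁ u) (≤cut d) ⟩
          T₁.⌈ u ⌉ ⊙ (T₁.⌈ x ⌉ ⊙ (c ⊙ T₂.⌈ y ⌉))      ≈⟨ ⊙-cong refl (⊙-assoc _ _ _) ⟩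
          T₁.⌈ u ⌉ ⊙ ((T₁.⌈ x ⌉ ⊙ c) ⊙ T₂.⌈ y ⌉)      ≤⟨ ⊙-mono ≤-refl (⊙-mono (absorbˡ a) ≤-refl) ⟩
          T₁.⌈ u ⌉ ⊙ (c ⊙ T₂.⌈ y ⌉)                   ∎
        cut (skip {x = x} {y = y} {x' = x'} {y' = y'} d d' a) = begin
          bound (ty u) ⊙ bound (ty v)                                     ≤⟨ ⊙-mono (≤cut d) (≤cut d') ⟩
          (T₁.⌈ x ⌉ ⊙ (c ⊙ T₂.⌈ y ⌉)) ⊙ (T₁.⌈ x' ⌉ ⊙ (c ⊙ T₂.⌈ y' ⌉))      ≈⟨ ⊙-assoc _ _ _ ⟨
          T₁.⌈ x ⌉ ⊙ ((c ⊙ T₂.⌈ y ⌉) ⊙ (T₁.⌈ x' ⌉ ⊙ (c ⊙ T₂.⌈ y' ⌉)))      ≈⟨ ⊙-cong refl (⊙-cong refl (⊙-assoc _ _ _)) ⟩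
          T₁.⌈ x ⌉ ⊙ ((c ⊙ T₂.⌈ y ⌉) ⊙ ((T₁.⌈ x' ⌉ ⊙ c) ⊙ T₂.⌈ y' ⌉))      ≈⟨ ⊙-cong refl (⊙-assoc _ _ _) ⟩
          T₁.⌈ x ⌉ ⊙ (((c ⊙ T₂.⌈ y ⌉) ⊙ (T₁.⌈ x' ⌉ ⊙ c)) ⊙ T₂.⌈ y' ⌉)      ≈⟨ ⊙-cong refl (⊙-cong (⊙-assoc _ _ _) refl) ⟨
          T₁.⌈ x ⌉ ⊙ ((c ⊙ (T₂.⌈ y ⌉ ⊙ (T₁.⌈ x' ⌉ ⊙ c))) ⊙ T₂.⌈ y' ⌉)      ≤⟨ ⊙-mono ≤-refl (⊙-mono (absorbᵐ {y} {x'} a) ≤-refl) ⟩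
          T₁.⌈ x ⌉ ⊙ (c ⊙ T₂.⌈ y' ⌉)                                       ∎

      bound-∥ : ∀ u v → bound (ty u) ⊓ bound (ty v) ≤ bound (ty (u ∥ v))
      bound-∥ u v = glb (u ∥ v)
        (≤-trans (⊓-mono (≤₁ u) (≤₁ v)) (T₁.bound-∥ u v))
        (≤-trans (⊓-mono (≤₂ u) (≤₂ v)) (T₂.bound-∥ u v))
        (λ { (parˡ d) → ≤-trans ⊓-lb₁ (≤cut d) ; (parʳ d) → ≤-trans ⊓-lb₂ (≤cut d) })

      cutTypes : Types
      cutTypes = record
        { Ty = Ty
        ; _≟ᵀ_ = ×-≡-dec (×-≡-dec T₁._≟ᵀ_ T₂._≟ᵀ_) (≡-dec (×-≡-dec T₁._≟ᵀ_ T₂._≟ᵀ_))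
        ; types = cartesianProduct pairs (powerset pairs)
        ; ty = ty
        ; ty∈ = λ u → ∈-cartesianProduct⁺ (∈-cartesianProduct⁺ (T₁.ty∈ u) (T₂.ty∈ u))
                                          (filter∈powerset (cut? u) pairs)
        ; bound = bound
        ; bound-atom = λ l → glb (atom l) (T₁.bound-atom l) (T₂.bound-atom l) (λ ())
        ; bound-⨟ = bound-⨟
        ; bound-∥ = bound-∥ }

  recogniser : ∀ f → Recogniser f
  recogniser (lit l) = litRecogniser l
  recogniser ∅       = ∅Recogniser
  recogniser (f ∪ g) = record
    { typing = pairTypes F.typing G.typing
    ; Acc = λ u → F.Acc u ⊎ G.Acc u
    ; Acc? = λ u → F.Acc? u ⊎-dec G.Acc? u
    ; complete = λ { (inj₁ p) → inj₁ (F.complete p) ; (inj₂ p) → inj₂ (G.complete p) }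
    ; sound = λ { (inj₁ a) → ≤-trans ⊓-lb₁ (≤-trans (F.sound a) ⊕-ub₁)
                ; (inj₂ a) → ≤-trans ⊓-lb₂ (≤-trans (G.sound a) ⊕-ub₂) } }
    where module F = Recogniser (recogniser f)
          module G = Recogniser (recogniser g)
  recogniser (f ∩ g) = record
    { typing = pairTypes F.typing G.typing
    ; Acc = λ u → F.Acc u × G.Acc u
    ; Acc? = λ u → F.Acc? u ×-dec G.Acc? u
    ; complete = λ (p , q) → F.complete p , G.complete q
    ; sound = λ (a , b) → ⊓-mono (F.sound a) (G.sound b) }
    where module F = Recogniser (recogniser f)
          module G = Recogniser (recogniser g)
  recogniser (f ⨾ g) = record
    { typing = C.cutTypes
    ; Acc = λ u → ∃₂ λ x y → Split u x y × F.Acc x × G.Acc y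
    ; Acc? = anyCut? (λ _ → no λ ()) (λ x y → F.Acc? x ×-dec G.Acc? y)
    ; complete = λ (x , y , s , p , q) → x , y , s , F.complete p , G.complete q
    ; sound = λ (x , y , s , a , b) → ≤-trans (C.≤cut s)
        (⊙-mono (F.sound a) (≤-trans (≤-reflexive (⊙-unitˡ _)) (G.sound b))) }
    where module F = Recogniser (recogniser f)
          module G = Recogniser (recogniser g)
          absurdᵐ : ∀ {y x} → ⊥ ⊎ (⊥ × ⊥) → 𝟏 ⊙ (G.⌈ y ⌉ ⊙ (F.⌈ x ⌉ ⊙ 𝟏)) ≤ 𝟏
          absurdᵐ (inj₁ ())
          absurdᵐ (inj₂ ())
          module C = CutTypes F.typing G.typing 𝟏 ≤-refl {A = λ _ → ⊥} (λ _ → no λ ())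
                       (λ ()) (λ ()) absurdᵐ
  recogniser (f ^+) = record
    { typing = C.cutTypes
    ; Acc = Acc⁺
    ; Acc? = λ u → F.Acc? u ⊎-dec anyCut? F.Acc? (λ x y → F.Acc? x ×-dec F.Acc? y) u
    ; complete = λ (n , p) → complete n p
    ; sound = sound }
    where
    module F = Recogniser (recogniser f)
    open ≤-Reasoning
    -- The summand `𝟏` is the empty chain, met when a graph falls into exactly two parts.
    c : Exp X
    c = 𝟏 ⊕ ⌊ f ⌋ ⁺
    f⊙c≤f⁺ : ⌊ f ⌋ ⊙ c ≤ ⌊ f ⌋ ⁺
    f⊙c≤f⁺ = ⊙⊕-lub (≤-trans (≤-reflexive (⊙-unitʳ _)) e≤e⁺) e⊙e⁺≤e⁺
    c⊙f⁺≤f⁺ : c ⊙ ⌊ f ⌋ ⁺ ≤ ⌊ f ⌋ ⁺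
    c⊙f⁺≤f⁺ = ⊕⊙-lub (≤-reflexive (⊙-unitˡ _)) e⁺⊙e⁺≤e⁺
    absorbʳ : ∀ {y} → F.Acc y → c ⊙ F.⌈ y ⌉ ≤ c
    absorbʳ a = ≤-trans (⊙-mono ≤-refl (≤-trans (F.sound a) e≤e⁺)) (≤-trans c⊙f⁺≤f⁺ ⊕-ub₂)
    absorbˡ : ∀ {x} → F.Acc x → F.⌈ x ⌉ ⊙ c ≤ c
    absorbˡ a = ≤-trans (⊙-mono (F.sound a) ≤-refl) (≤-trans f⊙c≤f⁺ ⊕-ub₂)
    c⊙c≤c : c ⊙ c ≤ c
    c⊙c≤c = ⊙⊕-lub (≤-reflexive (⊙-unitʳ _)) (≤-trans c⊙f⁺≤f⁺ ⊕-ub₂)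
    absorbᵐ : ∀ {y x} → F.Acc (y ⨟ x) ⊎ (F.Acc y × F.Acc x) → c ⊙ (F.⌈ y ⌉ ⊙ (F.⌈ x ⌉ ⊙ c)) ≤ c
    -- `y` and `x` are two halves of one part, which `F.bound-⨟` reassembles before it is absorbed.
    absorbᵐ {y} {x} (inj₁ a) = begin
      c ⊙ (F.⌈ y ⌉ ⊙ (F.⌈ x ⌉ ⊙ c))   ≈⟨ ⊙-cong refl (⊙-assoc _ _ _) ⟩
      c ⊙ ((F.⌈ y ⌉ ⊙ F.⌈ x ⌉) ⊙ c)   ≤⟨ ⊙-mono ≤-refl (⊙-mono (F.bound-⨟ y x) ≤-refl) ⟩
      c ⊙ (F.⌈ y ⨟ x ⌉ ⊙ c)           ≤⟨ ⊙-mono ≤-refl (absorbˡ a) ⟩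
      c ⊙ c                           ≤⟨ c⊙c≤c ⟩
      c                               ∎
    absorbᵐ {y} {x} (inj₂ (a , b)) =
      ≤-trans (⊙-mono ≤-refl (≤-trans (⊙-mono ≤-refl (absorbˡ b)) (absorbˡ a))) c⊙c≤c
    module C = CutTypes F.typing F.typing c ⊕-ub₁ F.Acc? absorbʳ absorbˡ absorbᵐ
    -- Either one part, or at least two with all but the first and the last hidden in the chain.
    Acc⁺ : SP L → Set
    Acc⁺ u = F.Acc u ⊎ ∃₂ λ x y → Cut F.Acc u x y × F.Acc x × F.Acc y
    complete : ∀ n {u} → Chain (_⊨ f) n u → Acc⁺ u
    complete zero    p = inj₁ (F.complete p)
    complete (suc n) (x , y , s , p , q) with complete n q
    ... | inj₁ a = inj₂ (x , y , split⇒cut s , F.complete p , a)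
    ... | inj₂ (z , w , d , a , b) = inj₂ (x , w , split-cut s d a , F.complete p , b)
    sound : ∀ {u} → Acc⁺ u → C.bound (C.ty u) ≤ ⌊ f ⌋ ⁺
    sound {u} (inj₁ a) = ≤-trans (C.≤₁ u) (≤-trans (F.sound a) e≤e⁺)
    sound (inj₂ (x , y , d , a , b)) = ≤-trans (C.≤cut d)
      (≤-trans (⊙-mono (F.sound a) (absorbʳ b)) f⊙c≤f⁺)

  -- Finite coverings by graphs, and the decision they yield.

  module _ (𝒯 : Types) where
    open Types 𝒯

    -- Closing gens under left multiplication by gens, up to types, stops because there are finitely many types.
    module Saturation (Good : SP L → Set₁) (gens : List (SP L))
      (gens-good : ∀ {u} → u ∈ gens → Good u)
      (step : ∀ {u} v → u ∈ gens → Good v → Good (u ⨟ v)) where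

      Closed : List (SP L) → Set
      Closed us = ∀ {u v} → u ∈ gens → v ∈ us → ∃ λ w → w ∈ us × ty w ≡ ty (u ⨟ v)

      Saturated : Set₁
      Saturated = Σ (List (SP L)) λ us →
        (∀ {u} → u ∈ us → Good u) × (∀ {u} → u ∈ gens → u ∈ us) × Closed us

      -- Every type of a graph that is not yet represented in `us` is listed in `missing`. Adding
      -- `u ⨟ v` strikes out its type, so `missing` gets shorter, and `n` is fuel for the recursion.
      search : ∀ n (missing : List Ty) → length missing ℕ.≤ n → ∀ us →
        (∀ {u} → u ∈ us → Good u) → (∀ {u} → u ∈ gens → u ∈ us) →
        (∀ u → ty u ∈ missing ⊎ (∃ λ w → w ∈ us × ty w ≡ ty u)) → Saturated
      search n missing len us good ⊇gens inv
        with any? (λ (u , v) → ¬? (any? (λ w → ty w ≟ᵀ ty (u ⨟ v)) us)) (cartesianProduct gens us)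
      ... | no closed = us , good , ⊇gens , λ {u} {v} i j →
              find (decidable-stable (any? (λ w → ty w ≟ᵀ ty (u ⨟ v)) us)
                     (λ ¬p → closed (lose (∈-cartesianProduct⁺ i j) ¬p)))
      ... | yes open′ with find open′
      ...   | (u , v) , i , new with inv (u ⨟ v)
      ...     | inj₂ (w , k , eq) = contradiction (lose k eq) new
      ...     | inj₁ k = continue n (ℕ.<-≤-trans shorter len)
        where
        other? : ∀ r → Dec (¬ r ≡ ty (u ⨟ v))
        other? r = ¬? (r ≟ᵀ ty (u ⨟ v))
        shorter : length (filter other? missing) ℕ.< length missing
        shorter = filter-notAll other? missing (lose k (λ ne → ne ≡.refl))
        u,v∈ : u ∈ gens × v ∈ us
        u,v∈ = ∈-cartesianProduct⁻ gens us i
        inv′ : ∀ x → ty x ∈ filter other? missing ⊎ (∃ λ w → w ∈ u ⨟ v ∷ us × ty w ≡ ty x)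
        inv′ x with ty x ≟ᵀ ty (u ⨟ v) | inv x
        ... | yes eq | _ = inj₂ (u ⨟ v , here ≡.refl , ≡.sym eq)
        ... | no ne  | inj₁ m = inj₁ (∈-filter⁺ other? m ne)
        ... | no ne  | inj₂ (w , m , eq) = inj₂ (w , there m , eq)
        continue : ∀ n → length (filter other? missing) ℕ.< n → Saturated
        continue (suc n) (ℕ.s≤s len′) = search n (filter other? missing) len′ (u ⨟ v ∷ us)
          (λ { (here ≡.refl) → step v (proj₁ u,v∈) (good (proj₂ u,v∈)) ; (there m) → good m })
          (λ m → there (⊇gens m)) inv′

      saturated : Saturated
      saturated = search (length types) types ℕ.≤-refl gens gens-good (λ m → m) (λ u → inj₁ (ty∈ u))

    -- The bounds come from a typing made for the right-hand expression `f`, while the graphs belong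
    -- to `e`. `Realises` ranges over all `E`, so that it can later be instantiated at a graph's own
    -- layout.
    Covering : IExp L → Set₁
    Covering e = Σ (List (SP L)) λ us → (∀ {u} → u ∈ us → Realises u e) × ⌊ e ⌋ ≤ sum ⌈_⌉ us

    covering : ∀ e → Covering e
    covering (lit l) = atom l ∷ [] , (λ { (here ≡.refl) E i j p → p }) , ≤-trans (bound-atom l) ⊕-ub₁
    covering ∅ = [] , (λ ()) , ≤-refl
    covering (e ∪ f) with covering e | covering f
    ... | us , p , h | vs , q , k = us ++ vs
      , (λ m → [ (λ i E s t r → inj₁ (p i E s t r)) , (λ i E s t r → inj₂ (q i E s t r)) ]′ (∈-++⁻ us m))
      , ⊕-lub (≤-trans h (sum-lub ⌈_⌉ us (λ i → sum-ub ⌈_⌉ (∈-++⁺ˡ i))))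
              (≤-trans k (sum-lub ⌈_⌉ vs (λ i → sum-ub ⌈_⌉ (∈-++⁺ʳ us i))))
    covering (e ⨾ f) with covering e | covering f
    ... | us , p , h | vs , q , k = map (λ (u , v) → u ⨟ v) (cartesianProduct us vs)
      , good
      , ≤-trans (⊙-mono h k) (sum-⊙-lub ⌈_⌉ ⌈_⌉ us vs λ {u} {v} i j →
          ≤-trans (bound-⨟ u v) (sum-ub ⌈_⌉ (∈-map⁺ _ (∈-cartesianProduct⁺ i j))))
      where
      good : ∀ {w} → w ∈ map (λ (u , v) → u ⨟ v) (cartesianProduct us vs) → Realises w (e ⨾ f)
      good m with ∈-map⁻ _ m
      ... | (u , v) , i , ≡.refl = λ E s t (n , a , b) →
        n , p (proj₁ (∈-cartesianProduct⁻ us vs i)) E s n a , q (proj₂ (∈-cartesianProduct⁻ us vs i)) E n t b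
    covering (e ∩ f) with covering e | covering f
    ... | us , p , h | vs , q , k = map (λ (u , v) → u ∥ v) (cartesianProduct us vs)
      , good
      , ≤-trans (⊓-mono h k) (sum-⊓-lub ⌈_⌉ ⌈_⌉ us vs λ {u} {v} i j →
          ≤-trans (bound-∥ u v) (sum-ub ⌈_⌉ (∈-map⁺ _ (∈-cartesianProduct⁺ i j))))
      where
      good : ∀ {w} → w ∈ map (λ (u , v) → u ∥ v) (cartesianProduct us vs) → Realises w (e ∩ f)
      good m with ∈-map⁻ _ m
      ... | (u , v) , i , ≡.refl = λ E s t (a , b) →
        p (proj₁ (∈-cartesianProduct⁻ us vs i)) E s t a , q (proj₂ (∈-cartesianProduct⁻ us vs i)) E s t b
    covering (e ^+) with covering e
    ... | us , p , h = close saturated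
      where
      once : ∀ {u} → u ∈ us → Realises u (e ^+)
      once i E s t r = zero , p i E s t r
      more : ∀ {u} v → u ∈ us → Realises v (e ^+) → Realises (u ⨟ v) (e ^+)
      more v i q E s t (n , a , b) = let (m , r) = q E n t b in suc m , n , p i E s n a , r
      open Saturation (λ u → Realises u (e ^+)) us once more
      close : Saturated → Covering (e ^+)
      -- The sum over `vs` is closed under multiplication by `e` from the left, because `⌈ u ⨟ v ⌉`
      -- is also the bound of some member of `vs`.
      close (vs , q , us⊆vs , closed) = vs , q , ⁺-least
        (≤-trans h (sum-lub ⌈_⌉ us (λ i → sum-ub ⌈_⌉ (us⊆vs i))))
        (≤-trans (⊙-mono h ≤-refl) (sum-⊙-lub ⌈_⌉ ⌈_⌉ us vs (λ i j → absorbed i j)))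
        where
        absorbed : ∀ {u v} → u ∈ us → v ∈ vs → ⌈ u ⌉ ⊙ ⌈ v ⌉ ≤ sum ⌈_⌉ vs
        absorbed {u} {v} i j with closed i j
        ... | w , k , eq = ≤-trans (bound-⨟ u v)
          (≡.subst (λ r → bound r ≤ sum ⌈_⌉ vs) eq (sum-ub ⌈_⌉ k))

  decide : ∀ e f → ⌊ e ⌋ ≤ ⌊ f ⌋ ⊎ (Σ (SP L) λ u → Realises u e × ¬ u ⊨ f)
  decide e f = check (covering typing e)
    where
    open Recogniser (recogniser f)
    check : Covering typing e → ⌊ e ⌋ ≤ ⌊ f ⌋ ⊎ (Σ (SP L) λ u → Realises u e × ¬ u ⊨ f)
    check (us , real , e≤us) with any? (λ u → ¬? (Acc? u)) us
    ... | yes bad = let (u , i , ¬a) = find bad in inj₂ (u , real i , λ p → ¬a (complete p))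
    ... | no good = inj₁ (≤-trans e≤us (sum-lub ⌈_⌉ us λ {u} i →
            sound (decidable-stable (Acc? u) (λ ¬a → good (lose i ¬a)))))

-- Laying out graphs on the natural numbers

module _ {L : Set} {E : L → ℕ → ℕ → Set} (E-< : ∀ {l a b} → E l a b → a ℕ.< b) where
  holds-< : ∀ g {a b} → Holds E g a b → a ℕ.< b
  holds-< (lit l) p = E-< p
  holds-< (g ∪ h) (inj₁ p) = holds-< g p
  holds-< (g ∪ h) (inj₂ p) = holds-< h p
  holds-< (g ⨾ h) (k , p , q) = ℕ.<-trans (holds-< g p) (holds-< h q)
  holds-< (g ∩ h) (p , q) = holds-< g p
  holds-< (g ^+) (zero , p) = holds-< g p
  holds-< (g ^+) (suc n , k , p , q) = ℕ.<-trans (holds-< g p) (holds-< (g ^+) (n , q))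

  -- A path ending in a set P of positions lives in E' as soon as P is closed under E'-predecessors other than i.
  module Prefix {E' : L → ℕ → ℕ → Set} (i : ℕ) (P : ℕ → Set) (into : ∀ {l a b} → E l a b → P b → E' l a b)
    (src : ∀ {l a b} → E' l a b → a ≡ i ⊎ P a) where

    join : ∀ (R S : ℕ → ℕ → Set) {a k b} → a ℕ.< k → i ℕ.≤ a → (P k → R a k × (a ≡ i ⊎ P a)) →
      S k b × (k ≡ i ⊎ P k) → (∃ λ k → R a k × S k b) × (a ≡ i ⊎ P a)
    join R S a<k i≤a f (s , inj₁ ≡.refl) = contradiction i≤a (ℕ.<⇒≱ a<k)
    join R S a<k i≤a f (s , inj₂ pk)     = let (r , q) = f pk in (_ , r , s) , q

    prefix : ∀ g {a b} → Holds E g a b → i ℕ.≤ a → P b → Holds E' g a b × (a ≡ i ⊎ P a)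
    prefix-iter : ∀ g n {a b} → Iter (Holds E g) n a b → i ℕ.≤ a → P b →
      Iter (Holds E' g) n a b × (a ≡ i ⊎ P a)

    prefix (lit l) p i≤a pb = into p pb , src (into p pb)
    prefix (g ∪ h) (inj₁ p) i≤a pb = let (q , r) = prefix g p i≤a pb in inj₁ q , r
    prefix (g ∪ h) (inj₂ p) i≤a pb = let (q , r) = prefix h p i≤a pb in inj₂ q , r
    prefix (g ⨾ h) (k , p , q) i≤a pb = join (Holds E' g) (Holds E' h) a<k i≤a (prefix g p i≤a)
      (prefix h q (ℕ.≤-trans i≤a (ℕ.<⇒≤ a<k)) pb)
      where a<k = holds-< g p
    prefix (g ∩ h) (p , q) i≤a pb = let (p' , r) = prefix g p i≤a pb in
      (p' , proj₁ (prefix h q i≤a pb)) , r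
    prefix (g ^+) (n , p) i≤a pb = let (q , r) = prefix-iter g n p i≤a pb in (n , q) , r

    prefix-iter g zero p i≤a pb = prefix g p i≤a pb
    prefix-iter g (suc n) (k , p , q) i≤a pb = join (Holds E' g) (Iter (Holds E' g) n) a<k i≤a (prefix g p i≤a)
      (prefix-iter g n q (ℕ.≤-trans i≤a (ℕ.<⇒≤ a<k)) pb)
      where a<k = holds-< g p

  -- The mirror image of `Prefix`: `Q` is closed under successors other than `j`, and `j` can only
  -- be the end of a path because positions increase.
  module Suffix {E' : L → ℕ → ℕ → Set} (j : ℕ) (Q : ℕ → Set) (into : ∀ {l a b} → E l a b → Q a → E' l a b)
    (tgt : ∀ {l a b} → E' l a b → b ≡ j ⊎ Q b) where

    join : ∀ (R S : ℕ → ℕ → Set) {a k b} → k ℕ.< b → b ℕ.≤ j → R a k × (k ≡ j ⊎ Q k) →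
      (Q k → S k b × (b ≡ j ⊎ Q b)) → (∃ λ k → R a k × S k b) × (b ≡ j ⊎ Q b)
    join R S k<b b≤j (r , inj₁ ≡.refl) f = contradiction b≤j (ℕ.<⇒≱ k<b)
    join R S k<b b≤j (r , inj₂ qk)     f = let (s , q) = f qk in (_ , r , s) , q

    suffix : ∀ g {a b} → Holds E g a b → b ℕ.≤ j → Q a → Holds E' g a b × (b ≡ j ⊎ Q b)
    suffix-iter : ∀ g n {a b} → Iter (Holds E g) n a b → b ℕ.≤ j → Q a →
      Iter (Holds E' g) n a b × (b ≡ j ⊎ Q b)

    suffix (lit l) p b≤j qa = into p qa , tgt (into p qa)
    suffix (g ∪ h) (inj₁ p) b≤j qa = let (q , r) = suffix g p b≤j qa in inj₁ q , r
    suffix (g ∪ h) (inj₂ p) b≤j qa = let (q , r) = suffix h p b≤j qa in inj₂ q , r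
    suffix (g ⨾ h) (k , p , q) b≤j qa = join (Holds E' g) (Holds E' h) k<b b≤j
      (suffix g p (ℕ.≤-trans (ℕ.<⇒≤ k<b) b≤j) qa) (suffix h q b≤j)
      where k<b = holds-< h q
    suffix (g ∩ h) (p , q) b≤j qa = let (p' , r) = suffix g p b≤j qa in
      (p' , proj₁ (suffix h q b≤j qa)) , r
    suffix (g ^+) (n , p) b≤j qa = let (q , r) = suffix-iter g n p b≤j qa in (n , q) , r

    suffix-iter g zero p b≤j qa = suffix g p b≤j qa
    suffix-iter g (suc n) (k , p , q) b≤j qa = join (Holds E' g) (Iter (Holds E' g) n) k<b b≤j
      (suffix g p (ℕ.≤-trans (ℕ.<⇒≤ k<b) b≤j) qa) (suffix-iter g n q b≤j)
      where k<b = holds-< (g ^+) (n , q)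

module _ {L : Set} where
  -- Wires have length at least 2, so that a word and its mirror image never label the same wire.
  Layout : SP L → ℕ → ℕ → Set
  Inner  : ∀ u {i j} → Layout u i j → ℕ → Set

  Layout (atom l) i j = suc (suc i) ℕ.≤ j
  Layout (u ⨟ v)  i j = ∃ λ k → Layout u i k × Layout v k j
  Layout (u ∥ v)  i j = Σ (Layout u i j) λ p → Σ (Layout v i j) λ q → ∀ m → Inner u p m → ¬ Inner v q m

  Inner (atom l) _             m = ⊥
  Inner (u ⨟ v)  (k , p , q)   m = Inner u p m ⊎ m ≡ k ⊎ Inner v q m
  Inner (u ∥ v)  (p , q , _)   m = Inner u p m ⊎ Inner v q m

  Wire : ∀ u {i j} → Layout u i j → L → ℕ → ℕ → Set
  Wire (atom k) {i} {j} _     l a b = l ≡ k × a ≡ i × b ≡ j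
  Wire (u ⨟ v)  (k , p , q)   l a b = Wire u p l a b ⊎ Wire v q l a b
  Wire (u ∥ v)  (p , q , _)   l a b = Wire u p l a b ⊎ Wire v q l a b

  layout-< : ∀ u {i j} → Layout u i j → i ℕ.< j
  layout-< (atom l) p = ℕ.<-trans (ℕ.n<1+n _) p
  layout-< (u ⨟ v) (k , p , q) = ℕ.<-trans (layout-< u p) (layout-< v q)
  layout-< (u ∥ v) (p , q , _) = layout-< u p

  inner-bounds : ∀ u {i j} (p : Layout u i j) {m} → Inner u p m → i ℕ.< m × m ℕ.< j
  inner-bounds (u ⨟ v) (k , p , q) (inj₁ a) = let (lo , hi) = inner-bounds u p a in
    lo , ℕ.<-trans hi (layout-< v q)
  inner-bounds (u ⨟ v) (k , p , q) (inj₂ (inj₁ ≡.refl)) = layout-< u p , layout-< v q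
  inner-bounds (u ⨟ v) (k , p , q) (inj₂ (inj₂ a)) = let (lo , hi) = inner-bounds v q a in
    ℕ.<-trans (layout-< u p) lo , hi
  inner-bounds (u ∥ v) (p , q , _) (inj₁ a) = inner-bounds u p a
  inner-bounds (u ∥ v) (p , q , _) (inj₂ a) = inner-bounds v q a

  wire-len : ∀ u {i j} (p : Layout u i j) {l a b} → Wire u p l a b → suc (suc a) ℕ.≤ b
  wire-len (atom l) p (_ , ≡.refl , ≡.refl) = p
  wire-len (u ⨟ v) (k , p , q) (inj₁ w) = wire-len u p w
  wire-len (u ⨟ v) (k , p , q) (inj₂ w) = wire-len v q w
  wire-len (u ∥ v) (p , q , _) (inj₁ w) = wire-len u p w
  wire-len (u ∥ v) (p , q , _) (inj₂ w) = wire-len v q w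

  wire-< : ∀ u {i j} (p : Layout u i j) {l a b} → Wire u p l a b → a ℕ.< b
  wire-< u p w = ℕ.<-trans (ℕ.n<1+n _) (wire-len u p w)

  wire-src : ∀ u {i j} (p : Layout u i j) {l a b} → Wire u p l a b → a ≡ i ⊎ Inner u p a
  wire-src (atom l) p (_ , eq , _) = inj₁ eq
  wire-src (u ⨟ v) (k , p , q) (inj₁ w) with wire-src u p w
  ... | inj₁ eq = inj₁ eq
  ... | inj₂ a  = inj₂ (inj₁ a)
  wire-src (u ⨟ v) (k , p , q) (inj₂ w) = inj₂ (inj₂ (wire-src v q w))
  wire-src (u ∥ v) (p , q , _) (inj₁ w) with wire-src u p w
  ... | inj₁ eq = inj₁ eq
  ... | inj₂ a  = inj₂ (inj₁ a)
  wire-src (u ∥ v) (p , q , _) (inj₂ w) with wire-src v q w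
  ... | inj₁ eq = inj₁ eq
  ... | inj₂ a  = inj₂ (inj₂ a)

  wire-tgt : ∀ u {i j} (p : Layout u i j) {l a b} → Wire u p l a b → b ≡ j ⊎ Inner u p b
  wire-tgt (atom l) p (_ , _ , eq) = inj₁ eq
  wire-tgt (u ⨟ v) (k , p , q) (inj₁ w) with wire-tgt u p w
  ... | inj₁ eq = inj₂ (inj₂ (inj₁ eq))
  ... | inj₂ a  = inj₂ (inj₁ a)
  wire-tgt (u ⨟ v) (k , p , q) (inj₂ w) with wire-tgt v q w
  ... | inj₁ eq = inj₁ eq
  ... | inj₂ a  = inj₂ (inj₂ (inj₂ a))
  wire-tgt (u ∥ v) (p , q , _) (inj₁ w) with wire-tgt u p w
  ... | inj₁ eq = inj₁ eq
  ... | inj₂ a  = inj₂ (inj₁ a)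
  wire-tgt (u ∥ v) (p , q , _) (inj₂ w) with wire-tgt v q w
  ... | inj₁ eq = inj₁ eq
  ... | inj₂ a  = inj₂ (inj₂ a)

  wire-src-≥ : ∀ u {i j} (p : Layout u i j) {l a b} → Wire u p l a b → i ℕ.≤ a
  wire-src-≥ u p w with wire-src u p w
  ... | inj₁ ≡.refl = ℕ.≤-refl
  ... | inj₂ a      = ℕ.<⇒≤ (proj₁ (inner-bounds u p a))

  wire-tgt-≤ : ∀ u {i j} (p : Layout u i j) {l a b} → Wire u p l a b → b ℕ.≤ j
  wire-tgt-≤ u p w with wire-tgt u p w
  ... | inj₁ ≡.refl = ℕ.≤-refl
  ... | inj₂ a      = ℕ.<⇒≤ (proj₂ (inner-bounds u p a))

  -- `pre` and `suf` are the closure conditions that `Prefix` and `Suffix` ask for; `inx` and `iny`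
  -- carry bounds and disjointness of inner positions through the recursion.
  record CutAt u {i j} (p : Layout u i j) (m : ℕ) : Set where
    field
      {front back} : SP L
      split : Split u front back
      px    : Layout front i m
      py    : Layout back m j
      inx   : ∀ {n} → Inner front px n → Inner u p n
      iny   : ∀ {n} → Inner back py n → Inner u p n
      pre   : ∀ {l a b} → Wire u p l a b → b ≡ m ⊎ Inner front px b → Wire front px l a b
      suf   : ∀ {l a b} → Wire u p l a b → a ≡ m ⊎ Inner back py a → Wire back py l a b

  -- A wire that would enter the wrong half is excluded by the order of positions if it lies in the
  -- other factor of a series composition, and by disjointness of the inner positions (`clash`) if
  -- it lies in the other parallel branch.
  cutAt : ∀ u {i j} (p : Layout u i j) {m} → Inner u p m → CutAt u p m
  cutAt (u ⨟ v) {i} {j} (k , p , q) {m} (inj₁ c) = record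
    { split = seqˡ split ; px = px ; py = k , py , q
    ; inx = λ a → inj₁ (inx a)
    ; iny = λ { (inj₁ a) → inj₁ (iny a) ; (inj₂ a) → inj₂ a }
    ; pre = λ { (inj₁ w) a → pre w a
              ; (inj₂ w) a → contradiction (before a)
                  (ℕ.<⇒≯ (ℕ.≤-<-trans (wire-src-≥ v q w) (wire-< v q w))) }
    ; suf = λ { (inj₁ w) (inj₁ a) → inj₁ (suf w (inj₁ a))
              ; (inj₁ w) (inj₂ (inj₁ a)) → inj₁ (suf w (inj₂ a))
              ; (inj₁ w) (inj₂ (inj₂ (inj₁ ≡.refl))) → contradiction (wire-tgt-≤ u p w) (ℕ.<⇒≱ (wire-< u p w))
              ; (inj₁ w) (inj₂ (inj₂ (inj₂ a))) → contradiction (wire-tgt-≤ u p w)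
                  (ℕ.<⇒≱ (ℕ.<-trans (proj₁ (inner-bounds v q a)) (wire-< u p w)))
              ; (inj₂ w) a → inj₂ w } }
    where
    open CutAt (cutAt u p c)
    before : ∀ {b} → b ≡ m ⊎ Inner front px b → b ℕ.< k
    before (inj₁ ≡.refl) = proj₂ (inner-bounds u p c)
    before (inj₂ a)      = proj₂ (inner-bounds u p (inx a))
  cutAt (u ⨟ v) (k , p , q) {m} (inj₂ (inj₁ ≡.refl)) = record
    { split = mid ; px = p ; py = q
    ; inx = inj₁ ; iny = λ a → inj₂ (inj₂ a)
    ; pre = λ { (inj₁ w) a → w
              ; (inj₂ w) a → contradiction (before a) (ℕ.<⇒≱ (ℕ.≤-<-trans (wire-src-≥ v q w) (wire-< v q w))) }
    ; suf = λ { (inj₁ w) a → contradiction (after a) (ℕ.<⇒≱ (ℕ.<-≤-trans (wire-< u p w) (wire-tgt-≤ u p w)))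
              ; (inj₂ w) a → w } }
    where
    before : ∀ {b} → b ≡ m ⊎ Inner u p b → b ℕ.≤ m
    before (inj₁ ≡.refl) = ℕ.≤-refl
    before (inj₂ a)      = ℕ.<⇒≤ (proj₂ (inner-bounds u p a))
    after : ∀ {b} → b ≡ m ⊎ Inner v q b → m ℕ.≤ b
    after (inj₁ ≡.refl) = ℕ.≤-refl
    after (inj₂ a)      = ℕ.<⇒≤ (proj₁ (inner-bounds v q a))
  cutAt (u ⨟ v) {i} {j} (k , p , q) {m} (inj₂ (inj₂ c)) = record
    { split = seqʳ split ; px = k , p , px ; py = py
    ; inx = λ { (inj₁ a) → inj₁ a ; (inj₂ (inj₁ a)) → inj₂ (inj₁ a) ; (inj₂ (inj₂ a)) → inj₂ (inj₂ (inx a)) }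
    ; iny = λ a → inj₂ (inj₂ (iny a))
    ; pre = λ { (inj₂ w) (inj₁ a) → inj₂ (pre w (inj₁ a))
              ; (inj₂ w) (inj₂ (inj₂ (inj₂ a))) → inj₂ (pre w (inj₂ a))
              ; (inj₂ w) (inj₂ (inj₂ (inj₁ ≡.refl))) → contradiction (wire-src-≥ v q w) (ℕ.<⇒≱ (wire-< v q w))
              ; (inj₂ w) (inj₂ (inj₁ a)) → contradiction (wire-src-≥ v q w)
                  (ℕ.<⇒≱ (ℕ.<-trans (wire-< v q w) (proj₂ (inner-bounds u p a))))
              ; (inj₁ w) a → inj₁ w }
    ; suf = λ { (inj₂ w) a → suf w a
              ; (inj₁ w) a → contradiction (after a)
                  (ℕ.<⇒≯ (ℕ.<-≤-trans (wire-< u p w) (wire-tgt-≤ u p w))) } }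
    where
    open CutAt (cutAt v q c)
    after : ∀ {b} → b ≡ m ⊎ Inner back py b → k ℕ.< b
    after (inj₁ ≡.refl) = proj₁ (inner-bounds v q c)
    after (inj₂ a)      = proj₁ (inner-bounds v q (iny a))
  cutAt (u ∥ v) {i} {j} (p , q , apart) {m} (inj₁ c) = record
    { split = parˡ split ; px = px ; py = py
    ; inx = λ a → inj₁ (inx a) ; iny = λ a → inj₁ (iny a)
    ; pre = λ { (inj₁ w) a → pre w a
              ; (inj₂ w) a → ⊥-elim (clash inx (wire-tgt v q w) a
                  λ { ≡.refl r → ℕ.<-irrefl ≡.refl (proj₂ (inner-bounds u p r)) }) }
    ; suf = λ { (inj₁ w) a → suf w a
              ; (inj₂ w) a → ⊥-elim (clash iny (wire-src v q w) a
                  λ { ≡.refl r → ℕ.<-irrefl ≡.refl (proj₁ (inner-bounds u p r)) }) } }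
    where
    open CutAt (cutAt u p c)
    clash : ∀ {b e} {I : ℕ → Set} → (∀ {n} → I n → Inner u p n) → b ≡ e ⊎ Inner v q b → b ≡ m ⊎ I b →
      (b ≡ e → Inner u p b → ⊥) → ⊥
    clash inc (inj₁ eq) (inj₁ ≡.refl) end = end eq c
    clash inc (inj₁ eq) (inj₂ a)      end = end eq (inc a)
    clash inc (inj₂ r)  (inj₁ ≡.refl) end = apart _ c r
    clash inc (inj₂ r)  (inj₂ a)      end = apart _ (inc a) r
  cutAt (u ∥ v) {i} {j} (p , q , apart) {m} (inj₂ c) = record
    { split = parʳ split ; px = px ; py = py
    ; inx = λ a → inj₂ (inx a) ; iny = λ a → inj₂ (iny a)
    ; pre = λ { (inj₂ w) a → pre w a
              ; (inj₁ w) a → ⊥-elim (clash inx (wire-tgt u p w) a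
                  λ { ≡.refl r → ℕ.<-irrefl ≡.refl (proj₂ (inner-bounds v q r)) }) }
    ; suf = λ { (inj₂ w) a → suf w a
              ; (inj₁ w) a → ⊥-elim (clash iny (wire-src u p w) a
                  λ { ≡.refl r → ℕ.<-irrefl ≡.refl (proj₁ (inner-bounds v q r)) }) } }
    where
    open CutAt (cutAt v q c)
    clash : ∀ {b e} {I : ℕ → Set} → (∀ {n} → I n → Inner v q n) → b ≡ e ⊎ Inner u p b → b ≡ m ⊎ I b →
      (b ≡ e → Inner v q b → ⊥) → ⊥
    clash inc (inj₁ eq) (inj₁ ≡.refl) end = end eq c
    clash inc (inj₁ eq) (inj₂ a)      end = end eq (inc a)
    clash inc (inj₂ r)  (inj₁ ≡.refl) end = apart _ r c
    clash inc (inj₂ r)  (inj₂ a)      end = apart _ r (inc a)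

  -- From truth in a layout to satisfaction.

  holds-tgt : ∀ {E : L → ℕ → ℕ → Set} {P : ℕ → Set} → (∀ {l a b} → E l a b → P b) →
    ∀ g {a b} → Holds E g a b → P b
  holds-tgt h (lit l) p = h p
  holds-tgt h (f ∪ g) (inj₁ p) = holds-tgt h f p
  holds-tgt h (f ∪ g) (inj₂ p) = holds-tgt h g p
  holds-tgt h (f ⨾ g) (k , p , q) = holds-tgt h g q
  holds-tgt h (f ∩ g) (p , q) = holds-tgt h f p
  holds-tgt h (g ^+) (zero , p) = holds-tgt h g p
  holds-tgt h (g ^+) (suc n , k , p , q) = holds-tgt h (g ^+) (n , q)

  wire⇒edge : ∀ u {i j} (p : Layout u i j) {l} → Wire u p l i j → Edge u l
  wire⇒edge (atom l) p (eq , _) = ≡.sym eq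
  wire⇒edge (u ⨟ v) (k , p , q) (inj₁ w) = ℕ.<⇒≱ (layout-< v q) (wire-tgt-≤ u p w)
  wire⇒edge (u ⨟ v) (k , p , q) (inj₂ w) = ℕ.<⇒≱ (layout-< u p) (wire-src-≥ v q w)
  wire⇒edge (u ∥ v) (p , q , _) (inj₁ w) = inj₁ (wire⇒edge u p w)
  wire⇒edge (u ∥ v) (p , q , _) (inj₂ w) = inj₂ (wire⇒edge v q w)

  -- The midpoint `k` of a composition is the target of a wire and lies before `j`, hence it is an
  -- inner position, where `u` can be cut.
  module Innercut u {i j} (p : Layout u i j) {k} (g : IExp L) (hg : Holds (Wire u p) g i k) (k<j : k ℕ.< j) where
    innerCut : CutAt u p k
    innerCut with holds-tgt (wire-tgt u p) g hg
    ... | inj₁ ≡.refl = contradiction k<j (ℕ.<-irrefl ≡.refl)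
    ... | inj₂ c      = cutAt u p c

    open CutAt innerCut public
    open Prefix (wire-< u p) {E' = Wire front px} i (λ b → b ≡ k ⊎ Inner front px b) pre
      (λ w → [ inj₁ , (λ a → inj₂ (inj₂ a)) ]′ (wire-src front px w)) public using (prefix)
    open Suffix (wire-< u p) {E' = Wire back py} j (λ a → a ≡ k ⊎ Inner back py a) suf
      (λ w → [ inj₁ , (λ a → inj₂ (inj₂ a)) ]′ (wire-tgt back py w)) public using (suffix; suffix-iter)

    prefix-holds : Holds (Wire front px) g i k
    prefix-holds = proj₁ (prefix g hg ℕ.≤-refl (inj₁ ≡.refl))

  -- Induction on `g`. A composition is cut at its midpoint, and `Prefix` and `Suffix` confine its
  -- two halves to the layouts of `front` and `back`.
  holds⇒⊨ : ∀ g u {i j} (p : Layout u i j) → Holds (Wire u p) g i j → u ⊨ g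
  iter⇒chain : ∀ g n u {i j} (p : Layout u i j) → Iter (Holds (Wire u p) g) n i j → Chain (_⊨ g) n u

  holds⇒⊨ (lit l) u p h = wire⇒edge u p h
  holds⇒⊨ (f ∪ g) u p (inj₁ h) = inj₁ (holds⇒⊨ f u p h)
  holds⇒⊨ (f ∪ g) u p (inj₂ h) = inj₂ (holds⇒⊨ g u p h)
  holds⇒⊨ (f ⨾ g) u p (k , hf , hg) = C.front , C.back , C.split , holds⇒⊨ f C.front C.px C.prefix-holds ,
    holds⇒⊨ g C.back C.py (proj₁ (C.suffix g hg ℕ.≤-refl (inj₁ ≡.refl)))
    where module C = Innercut u p f hf (holds-< (wire-< u p) g hg)
  holds⇒⊨ (f ∩ g) u p (hf , hg) = holds⇒⊨ f u p hf , holds⇒⊨ g u p hg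
  holds⇒⊨ (g ^+) u p (n , h) = n , iter⇒chain g n u p h

  iter⇒chain g zero u p h = holds⇒⊨ g u p h
  iter⇒chain g (suc n) u p (k , h , hs) = C.front , C.back , C.split , holds⇒⊨ g C.front C.px C.prefix-holds ,
    iter⇒chain g n C.back C.py (proj₁ (C.suffix-iter g n hs ℕ.≤-refl (inj₁ ≡.refl)))
    where module C = Innercut u p g h (holds-< (wire-< u p) (g ^+) (n , hs))

  wires⇒placed : ∀ u {i j} (p : Layout u i j) {E : L → ℕ → ℕ → Set} →
    (∀ {l a b} → Wire u p l a b → E l a b) → Placed E u i j
  wires⇒placed (atom l) p h = h (≡.refl , ≡.refl , ≡.refl)
  wires⇒placed (u ⨟ v) (k , p , q) h = k , wires⇒placed u p (λ w → h (inj₁ w)) , wires⇒placed v q (λ w → h (inj₂ w))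
  wires⇒placed (u ∥ v) (p , q , _) h = wires⇒placed u p (λ w → h (inj₁ w)) , wires⇒placed v q (λ w → h (inj₂ w))

  -- Existence of layouts.

  size : SP L → ℕ
  -- The minimal length of a wire.
  size (atom l) = 2
  size (u ⨟ v)  = size u ℕ.+ size v
  size (u ∥ v)  = size u ℕ.+ size v

  size>0 : ∀ u → 0 ℕ.< size u
  size>0 (atom l) = ℕ.s≤s ℕ.z≤n
  size>0 (u ⨟ v)  = ℕ.≤-trans (size>0 u) (ℕ.m≤m+n _ _)
  size>0 (u ∥ v)  = ℕ.≤-trans (size>0 u) (ℕ.m≤m+n _ _)

  -- The `size u` positions from `b` on are reserved for the inside of `u`, independently of its
  -- ends `i` and `j`. Parallel branches get consecutive blocks, which keeps their inner positions
  -- apart.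
  layout : ∀ u {i b j} → i ℕ.≤ b → b ℕ.+ size u ℕ.≤ j →
    Σ (Layout u i j) λ p → ∀ m → Inner u p m → b ℕ.< m × m ℕ.< b ℕ.+ size u
  layout (atom l) {i} {b} {j} i≤b b≤j =
    ℕ.≤-trans (ℕ.≤-trans (ℕ.≤-reflexive (ℕ.+-comm 2 i)) (ℕ.+-monoˡ-≤ 2 i≤b)) b≤j , λ _ ()
  layout (u ⨟ v) {i} {b} {j} i≤b b≤j
    with layout u {i} {b} {b ℕ.+ size u} i≤b ℕ.≤-refl
       | layout v {b ℕ.+ size u} {b ℕ.+ size u} {j} ℕ.≤-refl
           (ℕ.≤-trans (ℕ.≤-reflexive (ℕ.+-assoc b (size u) (size v))) b≤j)
  ... | p , hp | q , hq = (b ℕ.+ size u , p , q) , bounds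
    where
    assoc : b ℕ.+ size u ℕ.+ size v ≡ b ℕ.+ (size u ℕ.+ size v)
    assoc = ℕ.+-assoc b (size u) (size v)
    bounds : ∀ m → Inner u p m ⊎ m ≡ b ℕ.+ size u ⊎ Inner v q m →
      b ℕ.< m × m ℕ.< b ℕ.+ (size u ℕ.+ size v)
    bounds m (inj₁ a) = proj₁ (hp m a) ,
      ℕ.<-≤-trans (proj₂ (hp m a)) (ℕ.+-monoʳ-≤ b (ℕ.m≤m+n (size u) (size v)))
    bounds m (inj₂ (inj₁ ≡.refl)) = ℕ.m<m+n b (size>0 u) ,
      ℕ.+-monoʳ-< b (ℕ.m<m+n (size u) (size>0 v))
    bounds m (inj₂ (inj₂ a)) = ℕ.≤-<-trans (ℕ.m≤m+n b (size u)) (proj₁ (hq m a)) ,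
      ≡.subst (m ℕ.<_) assoc (proj₂ (hq m a))
  layout (u ∥ v) {i} {b} {j} i≤b b≤j
    with layout u {i} {b} {j} i≤b (ℕ.≤-trans (ℕ.+-monoʳ-≤ b (ℕ.m≤m+n (size u) (size v))) b≤j)
       | layout v {i} {b ℕ.+ size u} {j} (ℕ.≤-trans i≤b (ℕ.m≤m+n b (size u)))
           (ℕ.≤-trans (ℕ.≤-reflexive (ℕ.+-assoc b (size u) (size v))) b≤j)
  ... | p , hp | q , hq = (p , q , λ m a c → ℕ.<-asym (proj₂ (hp m a)) (proj₁ (hq m c))) , bounds
    where
    bounds : ∀ m → Inner u p m ⊎ Inner v q m → b ℕ.< m × m ℕ.< b ℕ.+ (size u ℕ.+ size v)
    bounds m (inj₁ a) = proj₁ (hp m a) ,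
      ℕ.<-≤-trans (proj₂ (hp m a)) (ℕ.+-monoʳ-≤ b (ℕ.m≤m+n (size u) (size v)))
    bounds m (inj₂ a) = ℕ.≤-<-trans (ℕ.m≤m+n b (size u)) (proj₁ (hq m a)) ,
      ≡.subst (m ℕ.<_) (ℕ.+-assoc b (size u) (size v)) (proj₂ (hq m a))

  record Model (e f : IExp L) : Set₁ where
    field
      E     : L → ℕ → ℕ → Set
      n     : ℕ
      0<n   : 0 ℕ.< n
      E-len : ∀ {l a b} → E l a b → suc (suc a) ℕ.≤ b
      yes-e : Holds E e 0 n
      no-f  : ¬ Holds E f 0 n

  separate : ∀ {e f} u → Realises u e → ¬ u ⊨ f → Model e f
  separate {e} {f} u real ¬f with layout u {0} {0} {size u} ℕ.z≤n ℕ.≤-refl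
  ... | p , _ = record
    { E = Wire u p ; n = size u ; 0<n = size>0 u ; E-len = wire-len u p
    ; yes-e = real _ 0 (size u) (wires⇒placed u p (λ w → w))
    ; no-f = λ h → ¬f (holds⇒⊨ f u p h) }

-- Eliminating the unit

mir : {X : Set} → Bool → Exp X → Exp X
mir false e = e
mir true  e = rev e

module _ {X : Set} where
  mir-mono : ∀ b {e f : Exp X} → e ≤ f → mir b e ≤ mir b f
  mir-mono false p = p
  mir-mono true  p = rev-mono p

  mir-⊕ : ∀ b (e f : Exp X) → mir b (e ⊕ f) ≡ₑ mir b e ⊕ mir b f
  mir-⊕ false e f = refl
  mir-⊕ true  e f = rev-⊕ e f

  mir-⊓ : ∀ b (e f : Exp X) → mir b (e ⊓ f) ≡ₑ mir b e ⊓ mir b f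
  mir-⊓ false e f = refl
  mir-⊓ true  e f = rev-⊓ e f

  mir-⁺ : ∀ b (e : Exp X) → mir b (e ⁺) ≡ₑ mir b e ⁺
  mir-⁺ false e = refl
  mir-⁺ true  e = rev-⁺ e

  mir-rev : ∀ b (e : Exp X) → mir b (rev e) ≡ₑ mir (not b) e
  mir-rev false e = refl
  mir-rev true  e = rev-rev e

  mir-𝟎 : ∀ b → mir {X} b 𝟎 ≡ₑ 𝟎
  mir-𝟎 false = refl
  mir-𝟎 true  = rev-𝟎

  mir-sub : ∀ b {a : Exp X} → a ≤ 𝟏 → mir b a ≡ₑ a
  mir-sub false p = refl
  mir-sub true  p = sub-rev p

  mir-1 : ∀ b (e : Exp X) → 𝟏 ⊓ mir b e ≡ₑ 𝟏 ⊓ e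
  mir-1 false e = refl
  mir-1 true  e = ax-1rev e

  guard : Bool → Exp X → Exp X
  guard true  e = e
  guard false e = 𝟎

  guard-≤ : ∀ m {e y : Exp X} → (m ≡ true → e ≤ y) → guard m e ≤ y
  guard-≤ true  h = h ≡.refl
  guard-≤ false h = 𝟎-min

  guard-≥ : ∀ {m} {e : Exp X} → m ≡ true → e ≤ guard m e
  guard-≥ ≡.refl = ≤-refl

  guard-⊓ : ∀ m n {e f y : Exp X} → (m ≡ true → n ≡ true → e ⊓ f ≤ y) → guard m e ⊓ guard n f ≤ y
  guard-⊓ true  true  h = h ≡.refl ≡.refl
  guard-⊓ true  false h = ≤-trans ⊓-lb₂ 𝟎-min
  guard-⊓ false n     h = ≤-trans ⊓-lb₁ 𝟎-min

∧-true⁻ : ∀ m n → m ∧ n ≡ true → m ≡ true × n ≡ true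
∧-true⁻ true true p = ≡.refl , ≡.refl

∧-true : ∀ {m n} → m ≡ true → n ≡ true → m ∧ n ≡ true
∧-true ≡.refl ≡.refl = ≡.refl

∨-true⁻ : ∀ m n → m ∨ n ≡ true → m ≡ true ⊎ n ≡ true
∨-true⁻ true  n p = inj₁ ≡.refl
∨-true⁻ false n p = inj₂ p

∨-trueˡ : ∀ {m} n → m ≡ true → m ∨ n ≡ true
∨-trueˡ n ≡.refl = ≡.refl

∨-trueʳ : ∀ m {n} → n ≡ true → m ∨ n ≡ true
∨-trueʳ m ≡.refl = Bool.∨-zeroʳ m

-- A test A records which variables are assumed to contain the empty word.
Test : ℕ → Set
Test = Vec Bool

tests : ∀ k → List (Test k)
tests zero    = [] ∷ []
tests (suc k) = map (true ∷_) (tests k) ++ map (false ∷_) (tests k)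

tests-complete : ∀ {k} (A : Test k) → A ∈ tests k
tests-complete [] = here ≡.refl
tests-complete {suc k} (true ∷ A)  = ∈-++⁺ˡ (∈-map⁺ (true ∷_) (tests-complete A))
tests-complete {suc k} (false ∷ A) = ∈-++⁺ʳ (map (true ∷_) (tests k)) (∈-map⁺ (false ∷_) (tests-complete A))

module _ {k : ℕ} where
  Letter : Set
  Letter = Fin k × Bool

  letterᴱ : Letter → Exp (Fin k)
  letterᴱ (x , b) = mir b (var x)

  letters : List Letter
  letters = cartesianProduct (allFin k) (true ∷ false ∷ [])

  letter≤ : ∀ l → letterᴱ l ≤ sum letterᴱ letters ⁺
  letter≤ (x , b) = ≤-trans (sum-ub letterᴱ (∈-cartesianProduct⁺ (∈-allFin x) (bool b))) e≤e⁺
    where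
    bool : ∀ b → b ∈ true ∷ false ∷ []
    bool true  = here ≡.refl
    bool false = there (here ≡.refl)

  open Completeness (×-≡-dec Fin._≟_ Data.Bool._≟_) letterᴱ (sum letterᴱ letters ⁺) letter≤ e⁺⊙e⁺≤e⁺ public using (⌊_⌋; decide)

  null : Test k → Exp (Fin k) → Bool
  null A (var x) = lookup A x
  null A 𝟎       = false
  null A 𝟏       = true
  null A (e ⊕ f) = null A e ∨ null A f
  null A (e ⊙ f) = null A e ∧ null A f
  null A (e ⊓ f) = null A e ∧ null A f
  null A (e ⁺)   = null A e
  null A (rev e) = null A e

  guardᴵ : Bool → IExp Letter → IExp Letter
  guardᴵ true  g = g
  guardᴵ false g = ∅

  -- The nonempty words of a product have two nonempty factors or exactly one; `m` and `n` tell
  -- whether the first and the second factor may be empty.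
  seqᴵ : Bool → Bool → IExp Letter → IExp Letter → IExp Letter
  seqᴵ m n g h = g ⨾ h ∪ guardᴵ m h ∪ guardᴵ n g

  -- pos A b e describes the nonempty words of e (mirrored if b), once the variables in A get the empty word added.
  pos : Test k → Bool → Exp (Fin k) → IExp Letter
  pos A b     (var x) = lit (x , b)
  pos A b     𝟎       = ∅
  pos A b     𝟏       = ∅
  pos A b     (e ⊕ f) = pos A b e ∪ pos A b f
  pos A false (e ⊙ f) = seqᴵ (null A e) (null A f) (pos A false e) (pos A false f)
  pos A true  (e ⊙ f) = seqᴵ (null A f) (null A e) (pos A true f) (pos A true e)
  pos A b     (e ⊓ f) = pos A b e ∩ pos A b f
  pos A b     (e ⁺)   = pos A b e ^+
  pos A b     (rev e) = pos A (not b) e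

  guardᴵ-≤ : ∀ m g {y} → (m ≡ true → ⌊ g ⌋ ≤ y) → ⌊ guardᴵ m g ⌋ ≤ y
  guardᴵ-≤ true  g h = h ≡.refl
  guardᴵ-≤ false g h = 𝟎-min

  ⊙-guardᴵ-≤ : ∀ m g {x y} → (m ≡ true → x ⊙ ⌊ g ⌋ ≤ y) → x ⊙ ⌊ guardᴵ m g ⌋ ≤ y
  ⊙-guardᴵ-≤ true  g h = h ≡.refl
  ⊙-guardᴵ-≤ false g h = ≤-trans (≤-reflexive (⊙-zeroʳ _)) 𝟎-min

  seqᴵ-lub : ∀ m n g h {y} → ⌊ g ⌋ ⊙ ⌊ h ⌋ ≤ y → (m ≡ true → ⌊ h ⌋ ≤ y) → (n ≡ true → ⌊ g ⌋ ≤ y) →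
    ⌊ seqᴵ m n g h ⌋ ≤ y
  seqᴵ-lub m n g h p q r = ⊕-lub (⊕-lub p (guardᴵ-≤ m h q)) (guardᴵ-≤ n g r)

  seqᴵ-⊙ : ∀ m n g h → ⌊ g ⌋ ⊙ ⌊ h ⌋ ≤ ⌊ seqᴵ m n g h ⌋
  seqᴵ-⊙ m n g h = ≤-trans ⊕-ub₁ ⊕-ub₁

  seqᴵ-left : ∀ {m} n g h → m ≡ true → ⌊ h ⌋ ≤ ⌊ seqᴵ m n g h ⌋
  seqᴵ-left n g h ≡.refl = ≤-trans ⊕-ub₂ ⊕-ub₁

  seqᴵ-right : ∀ m {n} g h → n ≡ true → ⌊ g ⌋ ≤ ⌊ seqᴵ m n g h ⌋
  seqᴵ-right m g h ≡.refl = ⊕-ub₂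

  -- The meets `α`, and the way back from `pos` to expressions.

  meet : Test k → List (Fin k) → Exp (Fin k)
  meet A []       = 𝟏
  meet A (x ∷ xs) = if lookup A x then var x ⊓ meet A xs else meet A xs

  α : Test k → Exp (Fin k)
  α A = meet A (allFin k)

  α≤𝟏 : ∀ A → α A ≤ 𝟏
  α≤𝟏 A = go (allFin k)
    where
    go : ∀ xs → meet A xs ≤ 𝟏
    go [] = ≤-refl
    go (x ∷ xs) with lookup A x
    ... | true  = ≤-trans ⊓-lb₂ (go xs)
    ... | false = go xs

  α-var : ∀ A x → lookup A x ≡ true → α A ≤ var x
  α-var A x Ax = go (allFin k) (∈-allFin x)
    where
    go : ∀ xs → x ∈ xs → meet A xs ≤ var x
    go (_ ∷ xs) (here ≡.refl) rewrite Ax = ⊓-lb₁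
    go (y ∷ xs) (there i) with lookup A y
    ... | true  = ≤-trans ⊓-lb₂ (go xs i)
    ... | false = go xs i

  α-glb : ∀ A {z} → z ≤ 𝟏 → (∀ x → lookup A x ≡ true → z ≤ var x) → z ≤ α A
  α-glb A {z} p h = go (allFin k)
    where
    go : ∀ xs → z ≤ meet A xs
    go [] = p
    go (x ∷ xs) with lookup A x in Ax
    ... | true  = ⊓-glb (h x Ax) (go xs)
    ... | false = go xs

  ∅ₜ : Test k
  ∅ₜ = replicate k false

  𝟏≤α∅ : 𝟏 ≤ α ∅ₜ
  𝟏≤α∅ = α-glb ∅ₜ ≤-refl λ x p → contradiction (≡.trans (≡.sym (lookup-replicate x false)) p) λ ()

  _∪ₜ_ : Test k → Test k → Test k
  _∪ₜ_ = zipWith _∨_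

  _⊑_ : Test k → Test k → Set
  A ⊑ B = ∀ x → lookup A x ≡ true → lookup B x ≡ true

  ⊑-∪ˡ : ∀ A B → A ⊑ (A ∪ₜ B)
  ⊑-∪ˡ A B x p = ≡.trans (lookup-zipWith _∨_ x A B) (∨-trueˡ (lookup B x) p)

  ⊑-∪ʳ : ∀ A B → B ⊑ (A ∪ₜ B)
  ⊑-∪ʳ A B x p = ≡.trans (lookup-zipWith _∨_ x A B) (∨-trueʳ (lookup A x) p)

  α-∪ : ∀ A B {z} → z ≤ α A → z ≤ α B → z ≤ α (A ∪ₜ B)
  α-∪ A B p q = α-glb (A ∪ₜ B) (≤-trans p (α≤𝟏 A)) λ x r → go x (∨-true⁻ (lookup A x) (lookup B x)
      (≡.trans (≡.sym (lookup-zipWith _∨_ x A B)) r))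
    where
    go : ∀ x → lookup A x ≡ true ⊎ lookup B x ≡ true → _ ≤ var x
    go x (inj₁ a) = ≤-trans p (α-var A x a)
    go x (inj₂ b) = ≤-trans q (α-var B x b)

  α⊙α : ∀ A B → α A ⊙ α B ≤ α (A ∪ₜ B)
  α⊙α A B = α-∪ A B (≤-trans (⊙-mono ≤-refl (α≤𝟏 B)) (≤-reflexive (⊙-unitʳ _))) (sub-drop (α≤𝟏 A))

  null-mono : ∀ {A B} → A ⊑ B → ∀ e → null A e ≡ true → null B e ≡ true
  null-mono s (var x) p = s x p
  null-mono s 𝟏 p = p
  null-mono {A} {B} s (e ⊕ f) p with ∨-true⁻ (null A e) (null A f) p
  ... | inj₁ q = ∨-trueˡ (null B f) (null-mono s e q)
  ... | inj₂ q = ∨-trueʳ (null B e) (null-mono s f q)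
  null-mono {A} s (e ⊙ f) p = let (q , r) = ∧-true⁻ (null A e) (null A f) p in
    ∧-true (null-mono s e q) (null-mono s f r)
  null-mono {A} s (e ⊓ f) p = let (q , r) = ∧-true⁻ (null A e) (null A f) p in
    ∧-true (null-mono s e q) (null-mono s f r)
  null-mono s (e ⁺) p = null-mono s e p
  null-mono s (rev e) p = null-mono s e p

  seqᴵ-mono : ∀ {m m' n n'} g g' h h' → (m ≡ true → m' ≡ true) → (n ≡ true → n' ≡ true) →
    ⌊ g ⌋ ≤ ⌊ g' ⌋ → ⌊ h ⌋ ≤ ⌊ h' ⌋ → ⌊ seqᴵ m n g h ⌋ ≤ ⌊ seqᴵ m' n' g' h' ⌋
  seqᴵ-mono {m} {m'} {n} {n'} g g' h h' p q r s = seqᴵ-lub m n g h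
    (≤-trans (⊙-mono r s) (seqᴵ-⊙ m' n' g' h'))
    (λ t → ≤-trans s (seqᴵ-left n' g' h' (p t))) (λ t → ≤-trans r (seqᴵ-right m' g' h' (q t)))

  pos-mono : ∀ {A B} → A ⊑ B → ∀ b e → ⌊ pos A b e ⌋ ≤ ⌊ pos B b e ⌋
  pos-mono s b (var x) = ≤-refl
  pos-mono s b 𝟎 = ≤-refl
  pos-mono s b 𝟏 = ≤-refl
  pos-mono s b (e ⊕ f) = ⊕-mono (pos-mono s b e) (pos-mono s b f)
  pos-mono s false (e ⊙ f) = seqᴵ-mono (pos _ false e) (pos _ false e) (pos _ false f) (pos _ false f)
    (null-mono s e) (null-mono s f) (pos-mono s false e) (pos-mono s false f)
  pos-mono s true (e ⊙ f) = seqᴵ-mono (pos _ true f) (pos _ true f) (pos _ true e) (pos _ true e)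
    (null-mono s f) (null-mono s e) (pos-mono s true f) (pos-mono s true e)
  pos-mono s b (e ⊓ f) = ⊓-mono (pos-mono s b e) (pos-mono s b f)
  pos-mono s b (e ⁺) = ⁺-mono (pos-mono s b e)
  pos-mono s b (rev e) = pos-mono s (not b) e

  full : Test k → Bool → Exp (Fin k) → Exp (Fin k)
  full A b e = ⌊ pos A b e ⌋ ⊕ guard (null A e) 𝟏

  full-mono : ∀ {A B} → A ⊑ B → ∀ b e → full A b e ≤ full B b e
  full-mono {A} {B} s b e = ⊕-mono (pos-mono s b e)
    (guard-≤ (null A e) λ p → guard-≥ (null-mono s e p))

  null-retract : ∀ A e → null A e ≡ true → α A ≤ e
  null-retract A (var x) p = α-var A x p
  null-retract A 𝟏 p = α≤𝟏 A
  null-retract A (e ⊕ f) p with ∨-true⁻ (null A e) (null A f) p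
  ... | inj₁ q = ≤-trans (null-retract A e q) ⊕-ub₁
  ... | inj₂ q = ≤-trans (null-retract A f q) ⊕-ub₂
  null-retract A (e ⊙ f) p = let (q , r) = ∧-true⁻ (null A e) (null A f) p in
    ≤-trans (sub-dup (α≤𝟏 A)) (⊙-mono (null-retract A e q) (null-retract A f r))
  null-retract A (e ⊓ f) p = let (q , r) = ∧-true⁻ (null A e) (null A f) p in
    ⊓-glb (null-retract A e q) (null-retract A f r)
  null-retract A (e ⁺) p = ≤-trans (null-retract A e p) e≤e⁺
  null-retract A (rev e) p =
    ≤-trans (≤-reflexive (sym (sub-rev (α≤𝟏 A)))) (rev-mono (null-retract A e p))

  -- `α A` is duplicated, one copy per factor; in the guarded summands a copy itself serves as the
  -- factor that is empty.
  seqᴵ-retract : ∀ A m n g h {x y} → α A ⊙ ⌊ g ⌋ ≤ x → α A ⊙ ⌊ h ⌋ ≤ y →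
    (m ≡ true → α A ≤ x) → (n ≡ true → α A ≤ y) → α A ⊙ ⌊ seqᴵ m n g h ⌋ ≤ x ⊙ y
  seqᴵ-retract A m n g h {x} {y} p q r s =
    ⊙⊕-lub (⊙⊕-lub
      (≤-trans (sub-split a≤𝟏 _ _) (⊙-mono p q))
      (⊙-guardᴵ-≤ m h (λ t → ≤-trans (⊙-mono (sub-dup a≤𝟏) ≤-refl)
        (≤-trans (≤-reflexive (sym (⊙-assoc _ _ _))) (⊙-mono (r t) q)))))
      (⊙-guardᴵ-≤ n g (λ t → ≤-trans (⊙-mono (sub-dup a≤𝟏) ≤-refl)
        (≤-trans (≤-reflexive (trans (sym (⊙-assoc _ _ _)) (sub-comm a≤𝟏 _))) (⊙-mono p (s t)))))
    where
    a≤𝟏 = α≤𝟏 A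

  -- `α A` pays for the words that `pos` adds on the assumption that the variables in `A` contain
  -- the empty word. It is distributed over products by `sub-split` and over iterations by `sub-⁺`.
  pos-retract : ∀ A b e → α A ⊙ ⌊ pos A b e ⌋ ≤ mir b e
  pos-retract A b (var x) = sub-drop (α≤𝟏 A)
  pos-retract A b 𝟎 = ≤-trans (≤-reflexive (⊙-zeroʳ _)) 𝟎-min
  pos-retract A b 𝟏 = ≤-trans (≤-reflexive (⊙-zeroʳ _)) 𝟎-min
  pos-retract A b (e ⊕ f) = ≤-trans
    (⊙⊕-lub (≤-trans (pos-retract A b e) ⊕-ub₁) (≤-trans (pos-retract A b f) ⊕-ub₂))
    (≤-reflexive (sym (mir-⊕ b e f)))
  pos-retract A false (e ⊙ f) = seqᴵ-retract A (null A e) (null A f) (pos A false e) (pos A false f)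
    (pos-retract A false e) (pos-retract A false f) (null-retract A e) (null-retract A f)
  pos-retract A true (e ⊙ f) = ≤-trans (seqᴵ-retract A (null A f) (null A e) (pos A true f) (pos A true e)
    (pos-retract A true f) (pos-retract A true e) (null-retract A (rev f)) (null-retract A (rev e)))
    (≤-reflexive (sym (rev-⊙ e f)))
  pos-retract A b (e ⊓ f) = ≤-trans (⊓-glb
      (≤-trans (⊙-mono ≤-refl ⊓-lb₁) (pos-retract A b e))
      (≤-trans (⊙-mono ≤-refl ⊓-lb₂) (pos-retract A b f)))
    (≤-reflexive (sym (mir-⊓ b e f)))
  pos-retract A b (e ⁺) = ≤-trans (sub-⁺ (α≤𝟏 A))
    (≤-trans (⁺-mono (pos-retract A b e)) (≤-reflexive (sym (mir-⁺ b e))))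
  pos-retract A b (rev e) = ≤-trans (pos-retract A (not b) e) (≤-reflexive (sym (mir-rev b e)))

  full-retract : ∀ A b e → α A ⊙ full A b e ≤ mir b e
  full-retract A b e = ⊙⊕-lub (pos-retract A b e) (go (null A e) (null-retract A e))
    where
    go : ∀ m → (m ≡ true → α A ≤ e) → α A ⊙ guard m 𝟏 ≤ mir b e
    go true  h = ≤-trans (≤-reflexive (trans (⊙-unitʳ _) (sym (mir-sub b (α≤𝟏 A))))) (mir-mono b (h ≡.refl))
    go false h = ≤-trans (≤-reflexive (⊙-zeroʳ _)) 𝟎-min

  -- The part of an expression below `𝟏`.

  units : Exp (Fin k) → Exp (Fin k)
  units e = sum (λ A → guard (null A e) (α A)) (tests k)

  units-ub : ∀ A e → null A e ≡ true → α A ≤ units e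
  units-ub A e p = ≤-trans (guard-≥ p) (sum-ub _ (tests-complete A))

  units-lub : ∀ e {y} → (∀ A → null A e ≡ true → α A ≤ y) → units e ≤ y
  units-lub e h = sum-lub _ (tests k) λ {A} _ → guard-≤ (null A e) (h A)

  units-⊓ : ∀ e f → units e ⊓ units f ≤ units (e ⊓ f)
  units-⊓ e f = sum-⊓-lub _ _ (tests k) (tests k) λ {A} {B} _ _ →
    guard-⊓ (null A e) (null B f) λ p q → ≤-trans (α-∪ A B ⊓-lb₁ ⊓-lb₂)
      (units-ub (A ∪ₜ B) (e ⊓ f) (∧-true (null-mono (⊑-∪ˡ A B) e p) (null-mono (⊑-∪ʳ A B) f q)))

  -- Under `𝟏 ⊓_` products become meets and `rev` disappears, while `units-⊓` merges meets by
  -- uniting tests. For `⁺` the first factor alone is kept.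
  𝟏⊓≤units : ∀ e → 𝟏 ⊓ e ≤ units e
  𝟏⊓≤units (var x) = ≤-trans
    (α-glb ⁅x⁆ ⊓-lb₁ λ y p → ≡.subst (λ y → 𝟏 ⊓ var x ≤ var y) (≡.sym (hit y p)) ⊓-lb₂)
    (units-ub ⁅x⁆ (var x) (≡.trans (lookup∘tabulate _ x) self))
    where
    ⁅x⁆ : Test k
    ⁅x⁆ = tabulate (λ y → does (y Fin.≟ x))
    hit : ∀ y → lookup ⁅x⁆ y ≡ true → y ≡ x
    hit y p with y Fin.≟ x | ≡.trans (≡.sym (lookup∘tabulate (λ y → does (y Fin.≟ x)) y)) p
    ... | yes q | _ = q
    ... | no _  | ()
    self : does (x Fin.≟ x) ≡ true
    self with x Fin.≟ x
    ... | yes _ = ≡.refl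
    ... | no ¬p = contradiction ≡.refl ¬p
  𝟏⊓≤units 𝟎 = ≤-trans ⊓-lb₂ 𝟎-min
  𝟏⊓≤units 𝟏 = ≤-trans ⊓-lb₁ (≤-trans 𝟏≤α∅ (units-ub ∅ₜ 𝟏 ≡.refl))
  𝟏⊓≤units (e ⊕ f) = ⊓⊕-lub
    (≤-trans (𝟏⊓≤units e) (units-lub e λ A p → units-ub A (e ⊕ f) (∨-trueˡ (null A f) p)))
    (≤-trans (𝟏⊓≤units f) (units-lub f λ A p → units-ub A (e ⊕ f) (∨-trueʳ (null A e) p)))
  𝟏⊓≤units (e ⊙ f) = ≤-trans (≤-reflexive (ax-1⊙ e f)) (≤-trans
    (⊓-glb (≤-trans (⊓-mono ≤-refl ⊓-lb₁) (𝟏⊓≤units e)) (≤-trans (⊓-mono ≤-refl ⊓-lb₂) (𝟏⊓≤units f)))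
    (units-⊓ e f))
  𝟏⊓≤units (e ⊓ f) = ≤-trans
    (⊓-glb (≤-trans (⊓-mono ≤-refl ⊓-lb₁) (𝟏⊓≤units e)) (≤-trans (⊓-mono ≤-refl ⊓-lb₂) (𝟏⊓≤units f)))
    (units-⊓ e f)
  𝟏⊓≤units (e ⁺) = ≤-trans (⊓-mono ≤-refl (≤-reflexive (⁺-unfoldˡ e))) (⊓⊕-lub (𝟏⊓≤units e)
    (≤-trans (≤-reflexive (ax-1⊙ e (e ⁺))) (≤-trans (⊓-mono ≤-refl ⊓-lb₁) (𝟏⊓≤units e))))
  𝟏⊓≤units (rev e) = ≤-trans (≤-reflexive (ax-1rev e)) (𝟏⊓≤units e)

  -- The expansion over all tests.

  expansion : Bool → Exp (Fin k) → Exp (Fin k)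
  expansion b e = sum (λ A → α A ⊙ full A b e) (tests k)

  expansion-ub : ∀ A b e {x} → x ≤ full A b e → α A ⊙ x ≤ expansion b e
  expansion-ub A b e p = ≤-trans (⊙-mono ≤-refl p) (sum-ub _ (tests-complete A))

  expansion-unit : ∀ A b e → null A e ≡ true → α A ≤ expansion b e
  expansion-unit A b e p = ≤-trans (≤-reflexive (sym (⊙-unitʳ _)))
    (expansion-ub A b e (≤-trans (guard-≥ p) ⊕-ub₂))

  guard𝟏-⊙ : ∀ m {x y : Exp (Fin k)} → (m ≡ true → x ≤ y) → guard m 𝟏 ⊙ x ≤ y
  guard𝟏-⊙ true  h = ≤-trans (≤-reflexive (⊙-unitˡ _)) (h ≡.refl)
  guard𝟏-⊙ false h = ≤-trans (≤-reflexive (⊙-zeroˡ _)) 𝟎-min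

  ⊙-guard𝟏 : ∀ m {x y : Exp (Fin k)} → (m ≡ true → x ≤ y) → x ⊙ guard m 𝟏 ≤ y
  ⊙-guard𝟏 true  h = ≤-trans (≤-reflexive (⊙-unitʳ _)) (h ≡.refl)
  ⊙-guard𝟏 false h = ≤-trans (≤-reflexive (⊙-zeroʳ _)) 𝟎-min

  full-⊙ : ∀ m n g h → (⌊ g ⌋ ⊕ guard m 𝟏) ⊙ (⌊ h ⌋ ⊕ guard n 𝟏) ≤ ⌊ seqᴵ m n g h ⌋ ⊕ guard (m ∧ n) 𝟏
  full-⊙ m n g h = ⊕⊙-lub
    (⊙⊕-lub (≤-trans (seqᴵ-⊙ m n g h) ⊕-ub₁) (⊙-guard𝟏 n λ p → ≤-trans (seqᴵ-right m g h p) ⊕-ub₁))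
    (guard𝟏-⊙ m λ p → ⊕-lub (≤-trans (seqᴵ-left n g h p) ⊕-ub₁)
      (guard-≤ n λ q → ≤-trans (guard-≥ (∧-true p q)) ⊕-ub₂))

  -- `null` of `e ⊙ f` lists the factors in the unmirrored order, hence the appeal to commutativity
  -- of `∧`.
  full-⊙-true : ∀ C e f → full C true f ⊙ full C true e ≤ full C true (e ⊙ f)
  full-⊙-true C e f = ≤-trans (full-⊙ (null C f) (null C e) (pos C true f) (pos C true e))
    (⊕-mono ≤-refl (guard-≤ (null C f ∧ null C e)
      (λ p → guard-≥ (≡.trans (Bool.∧-comm (null C e) (null C f)) p))))

  full-⁺ : ∀ m {x : Exp (Fin k)} → (x ⊕ guard m 𝟏) ⊙ (x ⁺ ⊕ guard m 𝟏) ≤ x ⁺ ⊕ guard m 𝟏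
  full-⁺ m = ⊕⊙-lub
    (⊙⊕-lub (≤-trans e⊙e⁺≤e⁺ ⊕-ub₁) (⊙-guard𝟏 m λ _ → ≤-trans e≤e⁺ ⊕-ub₁))
    (guard𝟏-⊙ m λ _ → ≤-refl)

  -- Tests commute with everything, so both move to the front. The slack in `x ≤ x'` and `y ≤ y'` is
  -- for `full-mono`, which lifts the factors to the united test.
  merge-⊙ : ∀ A B {x x' y y'} → x ≤ x' → y ≤ y' → (α A ⊙ x) ⊙ (α B ⊙ y) ≤ α (A ∪ₜ B) ⊙ (x' ⊙ y')
  merge-⊙ A B p q = ≤-trans (≤-reflexive (sub-merge (α≤𝟏 B) _ _ _)) (⊙-mono (α⊙α A B) (⊙-mono p q))

  merge-⊓ : ∀ A B {x x' y y'} → x ≤ x' → y ≤ y' → (α A ⊙ x) ⊓ (α B ⊙ y) ≤ α (A ∪ₜ B) ⊙ (x' ⊓ y')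
  merge-⊓ A B {x} {x'} {y} {y'} p q = begin
    (α A ⊙ x) ⊓ (α B ⊙ y)      ≈⟨ sub-⊓ (α≤𝟏 A) _ _ ⟩
    α A ⊙ (x ⊓ (α B ⊙ y))      ≈⟨ ⊙-cong refl (⊓-comm _ _) ⟩
    α A ⊙ ((α B ⊙ y) ⊓ x)      ≈⟨ ⊙-cong refl (sub-⊓ (α≤𝟏 B) _ _) ⟩
    α A ⊙ (α B ⊙ (y ⊓ x))      ≈⟨ ⊙-assoc _ _ _ ⟩
    (α A ⊙ α B) ⊙ (y ⊓ x)      ≤⟨ ⊙-mono (α⊙α A B) (≤-trans (≤-reflexive (⊓-comm y x)) (⊓-mono p q)) ⟩
    α (A ∪ₜ B) ⊙ (x' ⊓ y')     ∎
    where open ≤-Reasoning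

  -- `pos` never mentions `𝟏`, but its letters are variables that may contain the empty word, so
  -- `𝟏 ⊓ ⌊ pos C b e ⌋` need not vanish. In the presence of `α C` it lies below `e`, and then
  -- splits into units.
  unit-part : ∀ C b e {y} → (∀ D → null D e ≡ true → α (C ∪ₜ D) ≤ y) → α C ⊙ (𝟏 ⊓ ⌊ pos C b e ⌋) ≤ y
  unit-part C b e {y} h = begin
    α C ⊙ (𝟏 ⊓ p)              ≤⟨ ⊙-mono (sub-dup a≤𝟏) ≤-refl ⟩
    (α C ⊙ α C) ⊙ (𝟏 ⊓ p)      ≈⟨ ⊙-assoc _ _ _ ⟨
    α C ⊙ (α C ⊙ (𝟏 ⊓ p))      ≤⟨ ⊙-mono ≤-refl (⊓-glb (≤-trans (sub-drop a≤𝟏) ⊓-lb₁)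
                                    (≤-trans (⊙-mono ≤-refl ⊓-lb₂) (pos-retract C b e))) ⟩
    α C ⊙ (𝟏 ⊓ mir b e)        ≈⟨ ⊙-cong refl (mir-1 b e) ⟩
    α C ⊙ (𝟏 ⊓ e)              ≤⟨ ⊙-mono ⊕-ub₁ (𝟏⊓≤units e) ⟩
    -- A sum with one summand, so that `sum-⊙-lub` can distribute `α C` over `units e`.
    sum α (C ∷ []) ⊙ units e   ≤⟨ sum-⊙-lub α _ (C ∷ []) (tests k) (λ { {i = _} {D} (here ≡.refl) _ → step D (null D e) ≡.refl }) ⟩
    y                          ∎
    where
    open ≤-Reasoning
    a≤𝟏 = α≤𝟏 C
    p = ⌊ pos C b e ⌋
    step : ∀ D m → null D e ≡ m → α C ⊙ guard m (α D) ≤ y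
    step D true  q = ≤-trans (α⊙α C D) (h D q)
    step D false q = ≤-trans (≤-reflexive (⊙-zeroʳ _)) 𝟎-min

  -- Distributivity leaves four meets. `pos` with `pos` and `𝟏` with `𝟏` already have the right
  -- form; the mixed ones are handled by `unit-part`.
  full-⊓ : ∀ C b e f → α C ⊙ (full C b e ⊓ full C b f) ≤ expansion b (e ⊓ f)
  full-⊓ C b e f = begin
    α C ⊙ ((p ⊕ guard m 𝟏) ⊓ (q ⊕ guard n 𝟏))
      ≤⟨ ⊙-mono ≤-refl (⊕⊓-lub
           (⊓⊕-lub (≤-trans ⊕-ub₁ ⊕-ub₁) (≤-trans ⊕-ub₂ ⊕-ub₁))
           (≤-trans (⊓⊕-lub ⊕-ub₁ ⊕-ub₂) ⊕-ub₂)) ⟩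
    α C ⊙ ((p ⊓ q ⊕ p ⊓ guard n 𝟏) ⊕ (guard m 𝟏 ⊓ q ⊕ guard m 𝟏 ⊓ guard n 𝟏))
      ≤⟨ ⊙⊕-lub (⊙⊕-lub (expansion-ub C b (e ⊓ f) ⊕-ub₁) (right n ≡.refl))
                 (⊙⊕-lub (left m ≡.refl)
                   (expansion-ub C b (e ⊓ f) (≤-trans (guard-⊓ m n λ r s → ≤-trans ⊓-lb₁ (guard-≥ (∧-true r s))) ⊕-ub₂))) ⟩
    expansion b (e ⊓ f) ∎
    where
    open ≤-Reasoning
    p = ⌊ pos C b e ⌋
    q = ⌊ pos C b f ⌋
    m = null C e
    n = null C f
    right : ∀ n → null C f ≡ n → α C ⊙ (p ⊓ guard n 𝟏) ≤ expansion b (e ⊓ f)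
    right true r = ≤-trans (⊙-mono ≤-refl (≤-reflexive (⊓-comm _ _)))
      (unit-part C b e λ D s → expansion-unit (C ∪ₜ D) b (e ⊓ f)
        (∧-true (null-mono (⊑-∪ʳ C D) e s) (null-mono (⊑-∪ˡ C D) f r)))
    right false r = ≤-trans (⊙-mono ≤-refl ⊓-lb₂) (≤-trans (≤-reflexive (⊙-zeroʳ _)) 𝟎-min)
    left : ∀ m → null C e ≡ m → α C ⊙ (guard m 𝟏 ⊓ q) ≤ expansion b (e ⊓ f)
    left true r = unit-part C b f λ D s → expansion-unit (C ∪ₜ D) b (e ⊓ f)
        (∧-true (null-mono (⊑-∪ˡ C D) e r) (null-mono (⊑-∪ʳ C D) f s))
    left false r = ≤-trans (⊙-mono ≤-refl ⊓-lb₁) (≤-trans (≤-reflexive (⊙-zeroʳ _)) 𝟎-min)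

  -- The counterpart of `full-retract`; `b` is carried along because `rev` flips it. For `⁺`, the
  -- expansion is shown to be closed under multiplication by `mir b e` from the left, as `⁺-least`
  -- asks.
  expand : ∀ b e → mir b e ≤ expansion b e
  expand b (var x) = ≤-trans (≤-reflexive (sym (⊙-unitˡ _)))
    (≤-trans (⊙-mono 𝟏≤α∅ ≤-refl) (expansion-ub ∅ₜ b (var x) ⊕-ub₁))
  expand b 𝟎 = ≤-trans (≤-reflexive (mir-𝟎 b)) 𝟎-min
  expand b 𝟏 = ≤-trans (≤-reflexive (mir-sub b ≤-refl)) (≤-trans 𝟏≤α∅ (expansion-unit ∅ₜ b 𝟏 ≡.refl))
  expand b (e ⊕ f) = ≤-trans (≤-reflexive (mir-⊕ b e f)) (⊕-lub
    (≤-trans (expand b e) (sum-lub _ (tests k) λ {A} _ → expansion-ub A b (e ⊕ f)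
      (⊕-mono ⊕-ub₁ (guard-≤ (null A e) λ p → guard-≥ (∨-trueˡ (null A f) p)))))
    (≤-trans (expand b f) (sum-lub _ (tests k) λ {A} _ → expansion-ub A b (e ⊕ f)
      (⊕-mono ⊕-ub₂ (guard-≤ (null A f) λ p → guard-≥ (∨-trueʳ (null A e) p))))))
  expand false (e ⊙ f) = ≤-trans (⊙-mono (expand false e) (expand false f))
    (sum-⊙-lub _ _ (tests k) (tests k) λ {A} {B} _ _ → ≤-trans
      (merge-⊙ A B (full-mono (⊑-∪ˡ A B) false e) (full-mono (⊑-∪ʳ A B) false f))
      (expansion-ub (A ∪ₜ B) false (e ⊙ f)
        (full-⊙ (null (A ∪ₜ B) e) (null (A ∪ₜ B) f) (pos (A ∪ₜ B) false e) (pos (A ∪ₜ B) false f))))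
  expand true (e ⊙ f) = ≤-trans (≤-reflexive (rev-⊙ e f)) (≤-trans (⊙-mono (expand true f) (expand true e))
    (sum-⊙-lub _ _ (tests k) (tests k) λ {A} {B} _ _ → ≤-trans
      (merge-⊙ A B (full-mono (⊑-∪ˡ A B) true f) (full-mono (⊑-∪ʳ A B) true e))
      (expansion-ub (A ∪ₜ B) true (e ⊙ f) (full-⊙-true (A ∪ₜ B) e f))))
  expand b (e ⊓ f) = ≤-trans (≤-reflexive (mir-⊓ b e f)) (≤-trans (⊓-mono (expand b e) (expand b f))
    (sum-⊓-lub _ _ (tests k) (tests k) λ {A} {B} _ _ → ≤-trans
      (merge-⊓ A B (full-mono (⊑-∪ˡ A B) b e) (full-mono (⊑-∪ʳ A B) b f))
      (full-⊓ (A ∪ₜ B) b e f)))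
  expand b (e ⁺) = ≤-trans (≤-reflexive (mir-⁺ b e)) (⁺-least
    (≤-trans (expand b e) (sum-lub _ (tests k) λ {A} _ → expansion-ub A b (e ⁺) (⊕-mono e≤e⁺ ≤-refl)))
    (≤-trans (⊙-mono (expand b e) ≤-refl)
      (sum-⊙-lub _ _ (tests k) (tests k) λ {A} {B} _ _ → ≤-trans
        (merge-⊙ A B (full-mono (⊑-∪ˡ A B) b e) (full-mono (⊑-∪ʳ A B) b (e ⁺)))
        (expansion-ub (A ∪ₜ B) b (e ⁺) (full-⁺ (null (A ∪ₜ B) e))))))
  expand b (rev e) = ≤-trans (≤-reflexive (mir-rev b e)) (expand (not b) e)

-- From graphs to words

run : ℕ → ℕ → List ℕ
run i zero    = []
run i (suc n) = i ∷ run (suc i) n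

run-++ : ∀ i m n → run i (m ℕ.+ n) ≡ run i m ++ run (i ℕ.+ m) n
run-++ i zero    n rewrite ℕ.+-identityʳ i = ≡.refl
run-++ i (suc m) n rewrite ℕ.+-suc i m = ≡.cong (i ∷_) (run-++ (suc i) m n)

run-split : ∀ i n u {v} → run i n ≡ u ++ v →
  ∃₂ λ m m' → n ≡ m ℕ.+ m' × u ≡ run i m × v ≡ run (i ℕ.+ m) m'
run-split i n [] eq =
  0 , n , ≡.refl , ≡.refl , ≡.trans (≡.sym eq) (≡.cong (λ j → run j n) (≡.sym (ℕ.+-identityʳ i)))
run-split i (suc n) (x ∷ u) eq with run-split (suc i) n u (∷-injectiveʳ eq)
... | m , m' , p , q , r = suc m , m' , ≡.cong suc p , ≡.cong₂ _∷_ (≡.sym (∷-injectiveˡ eq)) q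
  , ≡.trans r (≡.cong (λ j → run j m') (≡.sym (ℕ.+-suc i m)))

run-injective : ∀ i n i' n' → run i (suc n) ≡ run i' n' → i ≡ i' × suc n ≡ n'
run-injective i zero i' (suc zero) eq = ∷-injectiveˡ eq , ≡.refl
run-injective i (suc n) i' (suc n') eq =
  ∷-injectiveˡ eq , ≡.cong suc (proj₂ (run-injective (suc i) n (suc i') n' (∷-injectiveʳ eq)))

-- A reversed run of length at least 2 starts with a descent, while runs ascend.
run≢reverse-run : ∀ i n i' n' → 2 ℕ.≤ n' → ¬ run i n ≡ reverse (run i' n')
run≢reverse-run i n i' 1 (ℕ.s≤s ())
run≢reverse-run i n i' (suc (suc m)) _ eq = go n (≡.trans eq tail)
  where
  tail : reverse (run i' (2 ℕ.+ m)) ≡ suc (i' ℕ.+ m) ∷ i' ℕ.+ m ∷ reverse (run i' m)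
  tail = ≡.trans (≡.cong reverse (≡.trans (≡.cong (run i') (ℕ.+-comm 2 m)) (run-++ i' m 2)))
                 (reverse-++ (run i' m) _)
  go : ∀ n → ¬ run i n ≡ suc (i' ℕ.+ m) ∷ i' ℕ.+ m ∷ reverse (run i' m)
  go (suc (suc n)) p = ℕ.<-irrefl (≡.sym (∷-injectiveˡ (∷-injectiveʳ p)))
    (ℕ.<-trans (ℕ.n<1+n _) (ℕ.s≤s (ℕ.≤-reflexive (≡.sym (∷-injectiveˡ p)))))

word : Bool → ℕ → ℕ → List ℕ
word false i n = run i n
word true  i n = reverse (run i n)

-- The positions themselves serve as letters, so a nonempty word remembers where it was read.
Span : Bool → ℕ → ℕ → List ℕ → Set
Span b i j w = ∃ λ n → j ≡ i ℕ.+ n × w ≡ word b i n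

span-≤ : ∀ b {i j w} → Span b i j w → i ℕ.≤ j
span-≤ b (n , ≡.refl , _) = ℕ.m≤m+n _ n

span-rev : ∀ b {i j w} → Span b i j w → Span (not b) i j (reverse w)
span-rev false (n , p , ≡.refl) = n , p , ≡.refl
span-rev true  (n , p , ≡.refl) = n , p , reverse-involutive _

span-[] : ∀ b {i j} → Span b i j [] → i ≡ j
span-[] b (zero , ≡.refl , _) = ≡.sym (ℕ.+-identityʳ _)
span-[] false (suc n , _ , ())
span-[] true {i} (suc n , _ , p) with reverse-injective {x = []} {y = run i (suc n)} p
... | ()

span-empty : ∀ b {i w} → Span b i i w → w ≡ []
span-empty b {i} (zero , _ , ≡.refl) = empty b
  where
  empty : ∀ b → word b i 0 ≡ []
  empty false = ≡.refl
  empty true  = ≡.refl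
span-empty b {i} (suc n , p , _) = contradiction (≡.trans p (ℕ.+-suc i n)) (ℕ.m≢1+m+n i)

cat : Bool → List ℕ → List ℕ → List ℕ
cat false u v = u ++ v
cat true  u v = v ++ u

span-at : ∀ b {i k j w} → Span b i j w → i ℕ.≤ k → k ℕ.≤ j →
  ∃₂ λ u v → Span b i k u × Span b k j v × w ≡ cat b u v
span-at b {i} (n , p , q) i≤k k≤j with ℕ.m≤n⇒∃[o]m+o≡n i≤k | ℕ.m≤n⇒∃[o]m+o≡n k≤j
... | m , ≡.refl | m' , r with ℕ.+-cancelˡ-≡ i n (m ℕ.+ m') (≡.trans (≡.sym p) (≡.trans (≡.sym r) (ℕ.+-assoc i m m')))
... | ≡.refl = word b i m , word b (i ℕ.+ m) m' , (m , ≡.refl , ≡.refl) , (m' , ≡.sym r , ≡.refl) , ≡.trans q (glue b)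
  where
  glue : ∀ b → word b i (m ℕ.+ m') ≡ cat b (word b i m) (word b (i ℕ.+ m) m')
  glue false = run-++ i m m'
  glue true  = ≡.trans (≡.cong reverse (run-++ i m m')) (reverse-++ (run i m) _)

span-cat : ∀ b {i j} u v → Span b i j (cat b u v) → ∃ λ k → Span b i k u × Span b k j v
span-cat false {i} u v (n , p , q) with run-split i n u (≡.sym q)
... | m , m' , ≡.refl , r , s = i ℕ.+ m , (m , ≡.refl , r) , (m' , ≡.trans p (≡.sym (ℕ.+-assoc i m m')) , s)
span-cat true {i} u v sp with span-rev true sp
... | sp' with span-cat false (reverse u) (reverse v) (≡.subst (Span false _ _) (reverse-++ v u) sp')
... | k , a , b = k , back a , back b
  where
  back : ∀ {i j w} → Span false i j (reverse w) → Span true i j w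
  back {w = w} c = ≡.subst (Span true _ _) (reverse-involutive w) (span-rev false c)

module Words {k : ℕ} (A : Test k) (E : Fin k × Bool → ℕ → ℕ → Set)
  (E-len : ∀ {l i j} → E l i j → suc (suc i) ℕ.≤ j) where

  -- The letter `(x , true)` stands for `rev (var x)`, so an edge with this label puts the reversed
  -- word of its segment into the language of `x`.
  σ : Fin k → Lang ℕ
  σ x w = (w ≡ [] × lookup A x ≡ true) ⊎ (∃ λ b → ∃₂ λ i j → E (x , b) i j × Span b i j w)

  E-< : ∀ {l i j} → E l i j → i ℕ.< j
  E-< p = ℕ.<-trans (ℕ.n<1+n _) (E-len p)

  pos-< : ∀ b e {i j} → Holds E (pos A b e) i j → i ℕ.< j
  pos-< b e = holds-< E-< (pos A b e)

  word-unique : ∀ b b' {i n i' n'} → 0 ℕ.< n → 2 ℕ.≤ n' → word b i n ≡ word b' i' n' →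
    b ≡ b' × i ≡ i' × n ≡ n'
  word-unique false false {i} {suc n} _ _ eq = ≡.refl , run-injective _ n _ _ eq
  word-unique true true {i} {suc n} _ _ eq = ≡.refl , run-injective _ n _ _ (reverse-injective eq)
  word-unique false true _ h eq = contradiction eq (run≢reverse-run _ _ _ _ h)
  word-unique true false {i} {n} _ h eq = contradiction
    (≡.trans (≡.sym (reverse-involutive (run i n))) (≡.cong reverse eq)) (run≢reverse-run i n _ _ h)

  -- Distinct letters fix the ends, and length at least 2 fixes the direction. A nonempty word of
  -- `σ x` thus identifies the edge it came from.
  span-unique : ∀ b b' {i j i' j' w} → i ℕ.< j → suc (suc i') ℕ.≤ j' → Span b i j w → Span b' i' j' w →
    b ≡ b' × i ≡ i' × j ≡ j'
  span-unique b b' {i} {i' = i'} p q (n , ≡.refl , r) (n' , ≡.refl , s)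
    with word-unique b b'
           (ℕ.+-cancelˡ-< i 0 n (≡.subst (ℕ._< i ℕ.+ n) (≡.sym (ℕ.+-identityʳ i)) p))
           (ℕ.+-cancelˡ-≤ i' 2 n' (≡.subst (ℕ._≤ i' ℕ.+ n') (ℕ.+-comm 2 i') q)) (≡.trans (≡.sym r) s)
  ... | ≡.refl , ≡.refl , ≡.refl = ≡.refl , ≡.refl , ≡.refl

  guardᴵ-holds⁻ : ∀ m g {i j} → Holds E (guardᴵ m g) i j → m ≡ true × Holds E g i j
  guardᴵ-holds⁻ true g p = ≡.refl , p

  guardᴵ-holds : ∀ {m} g {i j} → m ≡ true → Holds E g i j → Holds E (guardᴵ m g) i j
  guardᴵ-holds g ≡.refl p = p

  null⇒ε : ∀ e → null A e ≡ true → ⟦ e ⟧ σ []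
  null⇒ε (var x) p = inj₁ (≡.refl , p)
  null⇒ε 𝟏 p = ≡.refl
  null⇒ε (e ⊕ f) p with ∨-true⁻ (null A e) (null A f) p
  ... | inj₁ q = inj₁ (null⇒ε e q)
  ... | inj₂ q = inj₂ (null⇒ε f q)
  null⇒ε (e ⊙ f) p = let (q , r) = ∧-true⁻ (null A e) (null A f) p in
    [] , [] , ≡.refl , null⇒ε e q , null⇒ε f r
  null⇒ε (e ⊓ f) p = let (q , r) = ∧-true⁻ (null A e) (null A f) p in null⇒ε e q , null⇒ε f r
  null⇒ε (e ⁺) p = 0 , null⇒ε e p
  null⇒ε (rev e) p = null⇒ε e p

  Pow-ε : ∀ {K : Lang ℕ} n → Pow K n [] → K []
  Pow-ε zero p = p
  Pow-ε (suc n) ([] , [] , _ , p , _) = p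

  ε⇒null : ∀ e → ⟦ e ⟧ σ [] → null A e ≡ true
  ε⇒null (var x) (inj₁ (_ , p)) = p
  ε⇒null (var x) (inj₂ (b , i , j , p , sp)) = contradiction (span-[] b sp) (ℕ.<⇒≢ (E-< p))
  ε⇒null 𝟏 p = ≡.refl
  ε⇒null (e ⊕ f) (inj₁ p) = ∨-trueˡ (null A f) (ε⇒null e p)
  ε⇒null (e ⊕ f) (inj₂ p) = ∨-trueʳ (null A e) (ε⇒null f p)
  ε⇒null (e ⊙ f) ([] , [] , _ , p , q) = ∧-true (ε⇒null e p) (ε⇒null f q)
  ε⇒null (e ⊓ f) (p , q) = ∧-true (ε⇒null e p) (ε⇒null f q)
  ε⇒null (e ⁺) (n , p) = ε⇒null e (Pow-ε n p)
  ε⇒null (rev e) p = ε⇒null e p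

  seqᴵ-word : ∀ b e f {i j w} → Span b i j w →
    (∀ {i j w} → Span b i j w → Holds E (pos A b e) i j → ⟦ e ⟧ σ w) →
    (∀ {i j w} → Span b i j w → Holds E (pos A b f) i j → ⟦ f ⟧ σ w) →
    Holds E (seqᴵ (null A e) (null A f) (pos A b e) (pos A b f)) i j →
    ∃₂ λ u v → w ≡ cat b u v × ⟦ e ⟧ σ u × ⟦ f ⟧ σ v
  seqᴵ-word b e f sp he hf (inj₁ (inj₁ (k , p , q)))
    with span-at b sp (ℕ.<⇒≤ (pos-< b e p)) (ℕ.<⇒≤ (pos-< b f q))
  ... | u , v , su , sv , eq = u , v , eq , he su p , hf sv q
  seqᴵ-word b e f {w = w} sp he hf (inj₁ (inj₂ p)) with guardᴵ-holds⁻ (null A e) (pos A b f) p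
  ... | n , q = [] , w , unitˡ b , null⇒ε e n , hf sp q
    where
    unitˡ : ∀ b → w ≡ cat b [] w
    unitˡ false = ≡.refl
    unitˡ true  = ≡.sym (++-identityʳ w)
  seqᴵ-word b e f {w = w} sp he hf (inj₂ p) with guardᴵ-holds⁻ (null A f) (pos A b e) p
  ... | n , q = w , [] , unitʳ b , he sp q , null⇒ε f n
    where
    unitʳ : ∀ b → w ≡ cat b w []
    unitʳ false = ≡.sym (++-identityʳ w)
    unitʳ true  = ≡.refl

  Pow-cat : ∀ b {K : Lang ℕ} n u v → K u → Pow K n v → Pow K (suc n) (cat b u v)
  Pow-cat false n u v p q = u , v , ≡.refl , p , q
  Pow-cat true  n u v p q = Pow-snoc n (v , u , ≡.refl , q , p)

  Pow-uncat : ∀ b {K : Lang ℕ} n {w} → Pow K (suc n) w → ∃₂ λ u v → w ≡ cat b u v × K u × Pow K n v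
  Pow-uncat false n p = p
  Pow-uncat true  n p with Pow-unsnoc n p
  ... | v , u , eq , q , r = u , v , eq , r , q

  holds⇒word : ∀ b e {i j w} → Span b i j w → Holds E (pos A b e) i j → ⟦ e ⟧ σ w
  iter⇒word : ∀ b e n {i j w} → Span b i j w → Iter (Holds E (pos A b e)) n i j → Pow (⟦ e ⟧ σ) n w

  holds⇒word b (var x) sp p = inj₂ (b , _ , _ , p , sp)
  holds⇒word b (e ⊕ f) sp (inj₁ p) = inj₁ (holds⇒word b e sp p)
  holds⇒word b (e ⊕ f) sp (inj₂ p) = inj₂ (holds⇒word b f sp p)
  holds⇒word false (e ⊙ f) sp p = seqᴵ-word false e f sp (holds⇒word false e) (holds⇒word false f) p
  holds⇒word true (e ⊙ f) sp p =
    let (u , v , eq , q , r) = seqᴵ-word true f e sp (holds⇒word true f) (holds⇒word true e) p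
    in v , u , eq , r , q
  holds⇒word b (e ⊓ f) sp (p , q) = holds⇒word b e sp p , holds⇒word b f sp q
  holds⇒word b (e ⁺) sp (n , p) = n , iter⇒word b e n sp p
  holds⇒word b (rev e) sp p = holds⇒word (not b) e (span-rev b sp) p

  iter⇒word b e zero sp p = holds⇒word b e sp p
  iter⇒word b e (suc n) sp (k , p , q)
    with span-at b sp (ℕ.<⇒≤ (pos-< b e p)) (ℕ.<⇒≤ (pos-< b (e ⁺) (n , q)))
  ... | u , v , su , sv , ≡.refl = Pow-cat b n u v (holds⇒word b e su p) (iter⇒word b e n sv q)

  ε-at : ∀ b e {i w} → Span b i i w → ⟦ e ⟧ σ w → null A e ≡ true
  ε-at b e sp p = ε⇒null e (≡.subst (⟦ e ⟧ σ) (span-empty b sp) p)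

  -- If one of the two words is empty, its interval collapses to a point and a guarded summand of
  -- `seqᴵ` takes over.
  seqᴵ-holds : ∀ b e f {i j} u v → Span b i j (cat b u v) → ⟦ e ⟧ σ u → ⟦ f ⟧ σ v → i ℕ.< j →
    (∀ {i j w} → Span b i j w → ⟦ e ⟧ σ w → i ℕ.< j → Holds E (pos A b e) i j) →
    (∀ {i j w} → Span b i j w → ⟦ f ⟧ σ w → i ℕ.< j → Holds E (pos A b f) i j) →
    Holds E (seqᴵ (null A e) (null A f) (pos A b e) (pos A b f)) i j
  seqᴵ-holds b e f u v sp p q i<j he hf with span-cat b u v sp
  ... | k , su , sv with ℕ.m≤n⇒m<n∨m≡n (span-≤ b su) | ℕ.m≤n⇒m<n∨m≡n (span-≤ b sv)
  ... | inj₁ i<k | inj₁ k<j = inj₁ (inj₁ (k , he su p i<k , hf sv q k<j))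
  ... | inj₂ ≡.refl | _ = inj₁ (inj₂ (guardᴵ-holds (pos A b f) (ε-at b e su p) (hf sv q i<j)))
  ... | inj₁ i<k | inj₂ ≡.refl = inj₂ (guardᴵ-holds (pos A b e) (ε-at b f sv q) (he su p i<k))

  word⇒holds : ∀ b e {i j w} → Span b i j w → ⟦ e ⟧ σ w → i ℕ.< j → Holds E (pos A b e) i j
  -- The exponent may drop: empty factors are discarded, since `pos` describes nonempty words.
  word⇒iter : ∀ b e n {i j w} → Span b i j w → Pow (⟦ e ⟧ σ) n w → i ℕ.< j → Holds E (pos A b e ^+) i j

  word⇒holds b (var x) sp (inj₁ (≡.refl , _)) i<j = contradiction (span-[] b sp) (ℕ.<⇒≢ i<j)
  word⇒holds b (var x) sp (inj₂ (b' , i' , j' , p , sp')) i<j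
    with span-unique b b' i<j (E-len p) sp sp'
  ... | ≡.refl , ≡.refl , ≡.refl = p
  word⇒holds b 𝟏 sp ≡.refl i<j = contradiction (span-[] b sp) (ℕ.<⇒≢ i<j)
  word⇒holds b (e ⊕ f) sp (inj₁ p) i<j = inj₁ (word⇒holds b e sp p i<j)
  word⇒holds b (e ⊕ f) sp (inj₂ p) i<j = inj₂ (word⇒holds b f sp p i<j)
  word⇒holds false (e ⊙ f) sp (u , v , ≡.refl , p , q) i<j =
    seqᴵ-holds false e f u v sp p q i<j (word⇒holds false e) (word⇒holds false f)
  word⇒holds true (e ⊙ f) sp (u , v , ≡.refl , p , q) i<j =
    seqᴵ-holds true f e v u sp q p i<j (word⇒holds true f) (word⇒holds true e)
  word⇒holds b (e ⊓ f) sp (p , q) i<j = word⇒holds b e sp p i<j , word⇒holds b f sp q i<j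
  word⇒holds b (e ⁺) sp (n , p) i<j = word⇒iter b e n sp p i<j
  word⇒holds b (rev e) sp p i<j = word⇒holds (not b) e (span-rev b sp) p i<j

  word⇒iter b e zero sp p i<j = 0 , word⇒holds b e sp p i<j
  word⇒iter b e (suc n) sp p i<j with Pow-uncat b n p
  ... | u , v , ≡.refl , q , r with span-cat b u v sp
  ... | k , su , sv with ℕ.m≤n⇒m<n∨m≡n (span-≤ b su) | ℕ.m≤n⇒m<n∨m≡n (span-≤ b sv)
  ... | inj₁ i<k | inj₁ k<j = let (m , s) = word⇒iter b e n sv r k<j in suc m , k , word⇒holds b e su q i<k , s
  ... | inj₂ ≡.refl | _ = word⇒iter b e n sv r i<j
  ... | inj₁ i<k | inj₂ ≡.refl = 0 , word⇒holds b e su q i<k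

-- Deciding inequalities over finitely many variables.

Counterexample : ∀ {X : Set} → Exp X → Exp X → Set₁
Counterexample {X} e f = Σ Set λ B → Σ (X → Lang B) λ σ → Σ (List B) λ w → ⟦ e ⟧ σ w × ¬ ⟦ f ⟧ σ w

decideTest : ∀ {k} (e f : Exp (Fin k)) A → α A ⊙ full A false e ≤ f ⊎ Counterexample e f
decideTest e f A with decide (pos A false e) (pos A false f)
... | inj₂ (u , real , ¬f) = inj₂ (ℕ , σ , run 0 n , holds⇒word false e sp yes-e ,
        λ p → no-f (word⇒holds false f sp p 0<n))
  where
  open Model (separate {e = pos A false e} {f = pos A false f} u real ¬f)
  open Words A E E-len
  sp : Span false 0 n (run 0 n)
  sp = n , ≡.refl , ≡.refl
... | inj₁ p with null A e in eq | null A f in eq'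
-- The empty word separates the two expressions, so a model without edges will do.
...   | true | false = inj₂ (ℕ , σ , [] , null⇒ε e eq , λ q → contradiction (≡.trans (≡.sym eq') (ε⇒null f q)) λ ())
  where open Words A (λ _ _ _ → ⊥) (λ ())
...   | true | true = inj₁ (≤-trans (⊙-mono ≤-refl (⊕-mono p (guard-≥ eq'))) (full-retract A false f))
...   | false | _ = inj₁ (≤-trans (⊙-mono ≤-refl (⊕-mono p 𝟎-min)) (full-retract A false f))

decideExp : ∀ {k} (e f : Exp (Fin k)) → e ≤ f ⊎ Counterexample e f
decideExp {k} e f = check (go (tests k))
  where
  go : ∀ As → (∀ {A} → A ∈ As → α A ⊙ full A false e ≤ f) ⊎ Counterexample e f
  go [] = inj₁ λ ()
  go (A ∷ As) with decideTest e f A | go As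
  ... | inj₂ c | _ = inj₂ c
  ... | inj₁ p | inj₂ c = inj₂ c
  ... | inj₁ p | inj₁ ps = inj₁ λ { (here ≡.refl) → p ; (there i) → ps i }
  check : (∀ {A} → A ∈ tests k → α A ⊙ full A false e ≤ f) ⊎ Counterexample e f → e ≤ f ⊎ Counterexample e f
  check (inj₁ h) = inj₁ (≤-trans (expand false e) (sum-lub _ (tests k) h))
  check (inj₂ c) = inj₂ c

-- Arbitrary sets of variables

rename : (X → Y) → Exp X → Exp Y
rename q (var x) = var (q x)
rename q 𝟎       = 𝟎
rename q 𝟏       = 𝟏
rename q (e ⊕ f) = rename q e ⊕ rename q f
rename q (e ⊙ f) = rename q e ⊙ rename q f
rename q (e ⊓ f) = rename q e ⊓ rename q f
rename q (e ⁺)   = rename q e ⁺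
rename q (rev e) = rev (rename q e)

rename-∘ : ∀ {Z} (q : Y → Z) (r : X → Y) {s : X → Z} → q ∘ r ≗ s → ∀ e → rename q (rename r e) ≡ rename s e
rename-∘ q r h (var x) = ≡.cong var (h x)
rename-∘ q r h 𝟎       = ≡.refl
rename-∘ q r h 𝟏       = ≡.refl
rename-∘ q r h (e ⊕ f) = ≡.cong₂ _⊕_ (rename-∘ q r h e) (rename-∘ q r h f)
rename-∘ q r h (e ⊙ f) = ≡.cong₂ _⊙_ (rename-∘ q r h e) (rename-∘ q r h f)
rename-∘ q r h (e ⊓ f) = ≡.cong₂ _⊓_ (rename-∘ q r h e) (rename-∘ q r h f)
rename-∘ q r h (e ⁺)   = ≡.cong _⁺ (rename-∘ q r h e)
rename-∘ q r h (rev e) = ≡.cong rev (rename-∘ q r h e)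

rename-≡ₑ : ∀ (q : X → Y) {e f} → e ≡ₑ f → rename q e ≡ₑ rename q f
rename-≡ₑ q refl = refl
rename-≡ₑ q (sym d) = sym (rename-≡ₑ q d)
rename-≡ₑ q (trans d d') = trans (rename-≡ₑ q d) (rename-≡ₑ q d')
rename-≡ₑ q (⊕-cong d d') = ⊕-cong (rename-≡ₑ q d) (rename-≡ₑ q d')
rename-≡ₑ q (⊙-cong d d') = ⊙-cong (rename-≡ₑ q d) (rename-≡ₑ q d')
rename-≡ₑ q (⊓-cong d d') = ⊓-cong (rename-≡ₑ q d) (rename-≡ₑ q d')
rename-≡ₑ q (⁺-cong d) = ⁺-cong (rename-≡ₑ q d)
rename-≡ₑ q (rev-cong d) = rev-cong (rename-≡ₑ q d)
rename-≡ₑ q (⊕-comm e f) = ⊕-comm _ _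
rename-≡ₑ q (⊕-assoc e f g) = ⊕-assoc _ _ _
rename-≡ₑ q (⊕-zero e) = ⊕-zero _
rename-≡ₑ q (⊓-comm e f) = ⊓-comm _ _
rename-≡ₑ q (⊓-idem e) = ⊓-idem _
rename-≡ₑ q (⊓-assoc e f g) = ⊓-assoc _ _ _
rename-≡ₑ q (⊓-distr e f g) = ⊓-distr _ _ _
rename-≡ₑ q (absorb e f) = absorb _ _
rename-≡ₑ q (⊙-assoc e f g) = ⊙-assoc _ _ _
rename-≡ₑ q (⊙-zeroʳ e) = ⊙-zeroʳ _
rename-≡ₑ q (⊙-zeroˡ e) = ⊙-zeroˡ _
rename-≡ₑ q (⊙-distrʳ e f g) = ⊙-distrʳ _ _ _
rename-≡ₑ q (⊙-distrˡ e f g) = ⊙-distrˡ _ _ _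
rename-≡ₑ q (⁺-unfoldˡ e) = ⁺-unfoldˡ _
rename-≡ₑ q (⁺-unfoldʳ e) = ⁺-unfoldʳ _
rename-≡ₑ q (rev-rev e) = rev-rev _
rename-≡ₑ q (rev-⊕ e f) = rev-⊕ _ _
rename-≡ₑ q (rev-⊙ e f) = rev-⊙ _ _
rename-≡ₑ q (rev-⊓ e f) = rev-⊓ _ _
rename-≡ₑ q (rev-⁺ e) = rev-⁺ _
rename-≡ₑ q (⊙-unitˡ e) = ⊙-unitˡ _
rename-≡ₑ q (⊙-unitʳ e) = ⊙-unitʳ _
rename-≡ₑ q (ax-1⊙ e f) = ax-1⊙ _ _
rename-≡ₑ q (ax-1rev e) = ax-1rev _
rename-≡ₑ q (ax-comm e f) = ax-comm _ _
rename-≡ₑ q (ax-⊓ e f g) = ax-⊓ _ _ _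
rename-≡ₑ q (ax-⁺ e f g) = ax-⁺ _ _ _
rename-≡ₑ q (ind-ˡ d) = ind-ˡ (rename-≡ₑ q d)
rename-≡ₑ q (ind-ʳ d) = ind-ʳ (rename-≡ₑ q d)

module _ {k : ℕ} (q : Fin k → X) {B : Set} (σ : Fin k → Lang B) where
  push : X → Lang B
  push x w = ∃ λ i → q i ≡ x × σ i w

  push-⊆ : ∀ e → ⟦ e ⟧ σ ⊆ₗ ⟦ rename q e ⟧ push
  push-⊆ (var x) p = x , ≡.refl , p
  push-⊆ 𝟏 p = p
  push-⊆ (e ⊕ f) (inj₁ p) = inj₁ (push-⊆ e p)
  push-⊆ (e ⊕ f) (inj₂ p) = inj₂ (push-⊆ f p)
  push-⊆ (e ⊙ f) p = ∙-map (push-⊆ e) (push-⊆ f) p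
  push-⊆ (e ⊓ f) (p , r) = push-⊆ e p , push-⊆ f r
  push-⊆ (e ⁺) (n , p) = n , Pow-map (push-⊆ e) n p
  push-⊆ (rev e) p = push-⊆ e p

  Clash : Set
  Clash = ∃₂ λ i j → i ≢ j × q i ≡ q j

  -- The inclusion can fail only at a variable, where the label found and the label expected are
  -- compared in `Fin k`; two different ones are a `Clash`.
  push-⊇ : ∀ e {w} → ⟦ rename q e ⟧ push w → ⟦ e ⟧ σ w ⊎ Clash
  Pow-push : ∀ e n {w} → Pow (⟦ rename q e ⟧ push) n w → Pow (⟦ e ⟧ σ) n w ⊎ Clash

  push-⊇ (var x) (i , eq , p) with i Fin.≟ x
  ... | yes ≡.refl = inj₁ p
  ... | no ne      = inj₂ (i , x , ne , eq)
  push-⊇ 𝟏 p = inj₁ p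
  push-⊇ (e ⊕ f) (inj₁ p) with push-⊇ e p
  ... | inj₁ r = inj₁ (inj₁ r)
  ... | inj₂ c = inj₂ c
  push-⊇ (e ⊕ f) (inj₂ p) with push-⊇ f p
  ... | inj₁ r = inj₁ (inj₂ r)
  ... | inj₂ c = inj₂ c
  push-⊇ (e ⊙ f) (u , v , eq , p , r) with push-⊇ e p | push-⊇ f r
  ... | inj₁ p' | inj₁ r' = inj₁ (u , v , eq , p' , r')
  ... | inj₂ c  | _       = inj₂ c
  ... | inj₁ _  | inj₂ c  = inj₂ c
  push-⊇ (e ⊓ f) (p , r) with push-⊇ e p | push-⊇ f r
  ... | inj₁ p' | inj₁ r' = inj₁ (p' , r')
  ... | inj₂ c  | _       = inj₂ c
  ... | inj₁ _  | inj₂ c  = inj₂ c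
  push-⊇ (e ⁺) (n , p) with Pow-push e n p
  ... | inj₁ r = inj₁ (n , r)
  ... | inj₂ c = inj₂ c
  push-⊇ (rev e) p = push-⊇ e p

  Pow-push e zero p = push-⊇ e p
  Pow-push e (suc n) (u , v , eq , p , r) with push-⊇ e p | Pow-push e n r
  ... | inj₁ p' | inj₁ r' = inj₁ (u , v , eq , p' , r')
  ... | inj₂ c  | _       = inj₂ c
  ... | inj₁ _  | inj₂ c  = inj₂ c

infix 4 _⊑ₗ_
_⊑ₗ_ : Exp X → Exp X → Set₁
_⊑ₗ_ {X} e f = ∀ (B : Set) (σ : X → Lang B) → ⟦ e ⟧ σ ⊆ₗ ⟦ f ⟧ σ

-- Equality in X need not be decidable: a counterexample over Fin k either transfers
-- along q or exhibits two labels of the same variable, which are then merged.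
complete-labelled : ∀ k (q : Fin k → X) e f → rename q e ⊑ₗ rename q f → rename q e ≤ rename q f
complete-labelled k q e f h with decideExp e f
... | inj₁ p = rename-≡ₑ q p
... | inj₂ (B , σ , w , p , ¬p) with push-⊇ q σ f (h B (push q σ) (push-⊆ q σ e p))
...   | inj₁ r = contradiction r ¬p
complete-labelled (suc k) q e f h | inj₂ _ | inj₂ (i , j , i≢j , eq) =
  ≡.subst₂ _≤_ (same e) (same f) (complete-labelled k (q ∘ punchIn i) (rename merge e) (rename merge f)
    (≡.subst₂ _⊑ₗ_ (≡.sym (same e)) (≡.sym (same f)) h))
  where
  -- Label `i` is deleted, and its occurrences are redirected to the place of `j`; `punchIn i`
  -- undoes the renumbering.
  merge : Fin (suc k) → Fin k
  merge x with i Fin.≟ x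
  ... | yes _  = punchOut i≢j
  ... | no i≢x = punchOut i≢x
  merge-q : q ∘ punchIn i ∘ merge ≗ q
  merge-q x with i Fin.≟ x
  ... | yes ≡.refl = ≡.trans (≡.cong q (Fin.punchIn-punchOut i≢j)) (≡.sym eq)
  ... | no i≢x     = ≡.cong q (Fin.punchIn-punchOut i≢x)
  same : ∀ g → rename (q ∘ punchIn i) (rename merge g) ≡ rename q g
  same = rename-∘ (q ∘ punchIn i) merge merge-q

record Labelling (e f : Exp X) : Set where
  constructor labelling
  field
    {k}    : ℕ
    q      : Fin k → X
    eᴸ fᴸ  : Exp (Fin k)
    e-eq   : rename q eᴸ ≡ e
    f-eq   : rename q fᴸ ≡ f

Labelled : Exp X → Set
Labelled {X} e = ∃ λ k → Σ (Fin k → X) λ q → ∃ λ e' → rename q e' ≡ e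

pair : {e f : Exp X} → Labelled e → Labelled f → Labelling e f
pair {e = e} {f = f} (k , q , e' , p) (m , r , f' , s) = labelling ([ q , r ]′ ∘ splitAt k)
  (rename (_↑ˡ m) e') (rename (k ↑ʳ_) f')
  (≡.trans (rename-∘ _ (_↑ˡ m) (λ i → ≡.cong [ q , r ]′ (Fin.splitAt-↑ˡ k i m)) e') p)
  (≡.trans (rename-∘ _ (k ↑ʳ_) (λ i → ≡.cong [ q , r ]′ (Fin.splitAt-↑ʳ k m i)) f') s)

-- Every occurrence of a variable gets a label of its own, so that no two variables have to be
-- compared here.
label : (e : Exp X) → Labelled e
label (var x) = 1 , (λ _ → x) , var Fin.zero , ≡.refl
label 𝟎 = 0 , (λ ()) , 𝟎 , ≡.refl
label 𝟏 = 0 , (λ ()) , 𝟏 , ≡.refl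
label (e ⊕ f) with pair (label e) (label f)
... | labelling q e' f' p r = _ , q , e' ⊕ f' , ≡.cong₂ _⊕_ p r
label (e ⊙ f) with pair (label e) (label f)
... | labelling q e' f' p r = _ , q , e' ⊙ f' , ≡.cong₂ _⊙_ p r
label (e ⊓ f) with pair (label e) (label f)
... | labelling q e' f' p r = _ , q , e' ⊓ f' , ≡.cong₂ _⊓_ p r
label (e ⁺) with label e
... | k , q , e' , p = k , q , e' ⁺ , ≡.cong _⁺ p
label (rev e) with label e
... | k , q , e' , p = k , q , rev e' , ≡.cong rev p

completeness : (e f : Exp X) → e ⊑ₗ f → e ≤ f
completeness e f h with pair (label e) (label f)
... | labelling q e' f' ≡.refl ≡.refl = complete-labelled _ q e' f' h

theorem1 : {X : Set} (e f : Exp X) → (e ≡ₑ f) ⇔ (e ≃ f)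
theorem1 e f = mk⇔ soundness λ h → ≤-antisym
  (completeness e f (λ B σ {w} → Equivalence.to (h B σ w)))
  (completeness f e (λ B σ {w} → Equivalence.from (h B σ w)))
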